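{- For every $\delta>0$ there exists $n_0=n_0(\delta)=144/\delta^2$ such that the following holds for every integer $n\geq n_0$. Let $G$ be a multigraph whose edges are coloured with $n$ colours, such that for each colour $c$, the subgraph formed by the edges of colour $c$ (on the vertices incident to them) has at least $(3+\delta)n$ vertices and is a disjoint union of nontrivial cliques. Then $G$ contains a rainbow matching of size $n$.
   Context: A nontrivial clique is a complete graph on at least $2$ vertices. A matching in an edge-coloured multigraph is a set of pairwise vertex-disjoint edges; it is a rainbow matching if all its edges have distinct colours.
   Formalization: The number δ is taken to be rational instead of real; the real case follows on replacing δ by the least number of vertices of a colour class divided by n, minus 3. -}

module Defs where

open import Data.Nat using (ℕ)
open import Data.Fin using (Fin)
open import Data.Integer using (+_)
open import Data.Rational using (ℚ; _/_)
open import Data.Product using (Σ; ∃; _×_)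
open import Data.Sum using (_⊎_)
open import Data.List using (List; length)
open import Data.List.Relation.Unary.All using (All)
open import Data.List.Relation.Unary.AllPairs using (AllPairs)
open import Data.List.Relation.Unary.Unique.Propositional using (Unique)
open import Relation.Binary.PropositionalEquality using (_≡_; _≢_)
open import Relation.Nullary using (¬_)
open import Function.Bundles using (_⇔_)

ℕtoℚ : ℕ → ℚ
ℕtoℚ k = (+ k) / 1

-- A finite loopless multigraph on vertex set Fin V with E edges (indexed by
-- Fin E, so parallel edges are allowed), each edge coloured by one of n colours.
record ColouredMultigraph (n : ℕ) : Set where
  field
    V        : ℕ
    E        : ℕ
    end₁     : Fin E → Fin V
    end₂     : Fin E → Fin V
    loopless : ∀ e → end₁ e ≢ end₂ e
    colour   : Fin E → Fin n

module _ {n : ℕ} (G : ColouredMultigraph n) where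
  open ColouredMultigraph G

  Incident : Fin E → Fin V → Set
  Incident e u = end₁ e ≡ u ⊎ end₂ e ≡ u

  Joins : Fin E → Fin V → Fin V → Set
  Joins e u v = (end₁ e ≡ u × end₂ e ≡ v) ⊎ (end₁ e ≡ v × end₂ e ≡ u)

  Adj : Fin n → Fin V → Fin V → Set
  Adj c u v = ∃ λ e → colour e ≡ c × Joins e u v

  InColour : Fin n → Fin V → Set
  InColour c u = ∃ λ e → colour e ≡ c × Incident e u

  -- The colour-c subgraph (on the vertices incident to colour-c edges) is a
  -- disjoint union of nontrivial cliques: it is simple (no two parallel edges
  -- of colour c), and its vertex set is partitioned into parts (labelled by
  -- part : Fin V → ℕ), each of size ≥ 2, such that two distinct vertices are
  -- adjacent iff they lie in the same part.
  DisjointUnionOfNontrivialCliques : Fin n → Set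
  DisjointUnionOfNontrivialCliques c =
    (∀ e f → colour e ≡ c → colour f ≡ c →
       Joins f (end₁ e) (end₂ e) → e ≡ f)
    × Σ (Fin V → ℕ) λ part →
        (∀ u v → InColour c u → InColour c v → u ≢ v →
           Adj c u v ⇔ (part u ≡ part v))
        × (∀ u → InColour c u →
             ∃ λ v → v ≢ u × InColour c v × part v ≡ part u)

  AtLeastVertices : Fin n → ℚ → Set
  AtLeastVertices c K =
    ∃ λ (xs : List (Fin V)) →
      Unique xs × All (InColour c) xs × K Data.Rational.≤ ℕtoℚ (length xs)

  VertexDisjoint : Fin E → Fin E → Set
  VertexDisjoint e f = ∀ u → Incident e u → ¬ Incident f u

  RainbowMatching : List (Fin E) → Set
  RainbowMatching M =
    AllPairs (λ e f → VertexDisjoint e f × colour e ≢ colour f) M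

{-# OPTIONS --safe #-}
module Submission where

-- Write w_c(d) ∈ {0,1,2} for the number of ends of the matching edge d that the
-- colour c joins to distinct vertices outside a rainbow matching M of size m.
-- If the missing colour c₀ admits no augmentation, its outside vertices lie in
-- different cliques and all attach to M; switching edges of M along alternating
-- paths c₀ → c or c₀ → f → c makes c the missing colour, so the same holds for c,
-- and Σ_d w_c(d) ≥ m + Ω(δn). Let S₁ be the colours touched by c₀ (more than half
-- of M), S₂ those touched by many colours of S₁, and S = S₁ ∪ S₂. Columns outside S
-- have weight at most |S|, so Σ_{c,d∈S} w_c(d) ≥ |S|² + Ω(δn)|S|, and some d ∈ S
-- has Ω(δn) colours c with w_c(d) = 2 and w_d(c) ≥ 1. For two such colours,
-- c₀ → (f →) c₁ → d → c₂ followed by a c₂-edge at the end of d that c₁ has freed is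
-- an augmentation, unless two of the outside vertices used coincide. Injectivity of
-- the labels bounds these coincidences by O(m/(δn)), which δ²n ≥ 144 makes smaller.
-- Quantitatively, e = ⌊√n⌋ satisfies 12e ≤ δn, and "many" means at least 6e.

open import Defs
open import Level using (0ℓ)
open import Data.Nat as ℕ using (ℕ; zero; suc; z≤n; s≤s; _+_; _*_; _≤_; _<_; _≤?_; _≟_)
open import Data.Nat.Properties hiding (_≟_; _≤?_)
open import Data.Nat.Tactic.RingSolver using (solve-∀)
import Data.Integer as ℤ
import Data.Integer.Properties as ℤ
import Data.Rational as ℚ
import Data.Rational.Properties as ℚ
import Data.Rational.Unnormalised as ℚᵘ
import Data.Rational.Unnormalised.Properties as ℚᵘ
open import Data.Rational.Solver using (module +-*-Solver)
open import Data.Bool using (Bool; true; false; not; if_then_else_)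
import Data.Bool.Properties
open import Data.Fin using (Fin; zero; suc; finToFun; funToFin)
open import Data.Fin.Properties using (any?; all?)
import Data.Fin.Properties as Fin
open import Data.Maybe using (Maybe; just; nothing; _<∣>_)
import Data.Maybe.Properties
open import Data.Product using (Σ; ∃; _×_; _,_; proj₁; proj₂)
open import Data.Product.Properties using (≡-dec; ,-injectiveˡ)
open import Data.Sum using (_⊎_; inj₁; inj₂)
import Data.Sum
open import Data.Empty using (⊥; ⊥-elim)
open import Data.List using (List; []; _∷_; length; tabulate)
open import Data.List.Properties using (length-tabulate)
open import Data.List.Membership.Propositional using (_∈_; _∉_)
open import Data.List.Relation.Binary.Subset.Propositional using (_⊆_)
open import Data.List.Relation.Unary.Any using (here; there)
open import Data.List.Relation.Unary.All using (All; []; _∷_)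
import Data.List.Relation.Unary.All as All
open import Data.List.Relation.Unary.AllPairs using ([]; _∷_)
open import Data.List.Relation.Unary.AllPairs.Properties using (tabulate⁺)
open import Data.List.Relation.Unary.Unique.Propositional using (Unique)
open import Data.Vec.Functional using (updateAt) renaming (_∷_ to _∷ᶠ_)
open import Data.Vec.Functional.Properties using (updateAt-updates; updateAt-minimal)
open import Algebra.Properties.Semiring.Sum +-*-semiring
  using (sum; ∑-distrib-+; ∑-comm; sum-cong-≗; *-distribˡ-sum; *-distribʳ-sum)
open import Function using (_∘_; id; flip; const)
open import Function.Bundles using (Equivalence)
open import Relation.Nullary using (Dec; yes; no; ¬_; does; contradiction; _×-dec_; _⊎-dec_; _→-dec_; ¬?; map′)
open import Relation.Unary using (Pred; Decidable)
open import Relation.Binary.PropositionalEquality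

-- Sums and counting over Fin

private variable
  m : ℕ
  X Y Z : Set
  Φ Ψ Θ : Pred (Fin m) 0ℓ

≤-cancel : ∀ {a b} c {x y} → x ≡ a + c → y ≡ b + c → x ≤ y → a ≤ b
≤-cancel {a} {b} c refl refl h = +-cancelʳ-≤ c a b h

sum-mono : {f g : Fin m → ℕ} → (∀ i → f i ≤ g i) → sum f ≤ sum g
sum-mono {zero} h = z≤n
sum-mono {suc m} h = +-mono-≤ (h zero) (sum-mono (h ∘ suc))

sum-const : ∀ m c → sum {m} (λ _ → c) ≡ m * c
sum-const zero c = refl
sum-const (suc m) c = cong (c +_) (sum-const m c)

sum-∃< : (f g : Fin m → ℕ) → sum f < sum g → ∃ λ i → f i < g i
sum-∃< {m} f g h with any? (λ i → f i ℕ.<? g i)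
... | yes p = p
... | no ¬p = contradiction (sum-mono λ i → ≮⇒≥ λ lt → ¬p (i , lt)) (<⇒≱ h)

term≤sum : (f : Fin m → ℕ) → ∀ i → f i ≤ sum f
term≤sum f zero = m≤m+n _ _
term≤sum f (suc i) = ≤-trans (term≤sum (f ∘ suc) i) (m≤n+m _ _)

χ : Dec X → ℕ
χ d = if does d then 1 else 0

χ≤1 : (d : Dec X) → χ d ≤ 1
χ≤1 (yes _) = ≤-refl
χ≤1 (no _) = z≤n

χ-yes : (d : Dec X) → X → χ d ≡ 1
χ-yes (yes _) a = refl
χ-yes (no ¬a) a = contradiction a ¬a

χ-no : (d : Dec X) → ¬ X → χ d ≡ 0
χ-no (yes a) ¬a = contradiction a ¬a
χ-no (no _) _ = refl

χ-⊎ : (a : Dec X) (b : Dec Y) (c : Dec Z) → (X → Y ⊎ Z) → χ a ≤ χ b + χ c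
χ-⊎ (no _) b c h = z≤n
χ-⊎ (yes x) b c h with h x
... | inj₁ y = ≤-trans (≤-reflexive (sym (χ-yes b y))) (m≤m+n _ _)
... | inj₂ z = ≤-trans (≤-reflexive (sym (χ-yes c z))) (m≤n+m _ _)

χ-mono : (a : Dec X) (b : Dec Y) → (X → Y) → χ a ≤ χ b
χ-mono (no _) b h = z≤n
χ-mono (yes x) b h = ≤-reflexive (sym (χ-yes b (h x)))

♯ : Decidable Φ → ℕ
♯ P? = sum (χ ∘ P?)

♯-⊎ : (P? : Decidable Φ) (Q? : Decidable Ψ) (R? : Decidable Θ) →
  (∀ i → Φ i → Ψ i ⊎ Θ i) → ♯ P? ≤ ♯ Q? + ♯ R?
♯-⊎ P? Q? R? h = ≤-trans (sum-mono λ i → χ-⊎ (P? i) (Q? i) (R? i) (h i))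
  (≤-reflexive (∑-distrib-+ (χ ∘ Q?) (χ ∘ R?)))

♯-mono : (P? : Decidable Φ) (Q? : Decidable Ψ) → (∀ i → Φ i → Ψ i) → ♯ P? ≤ ♯ Q?
♯-mono P? Q? h = sum-mono λ i → χ-mono (P? i) (Q? i) (h i)

♯≤ : {Φ : Pred (Fin m) 0ℓ} (P? : Decidable Φ) → ♯ P? ≤ m
♯≤ {m} P? = ≤-trans (sum-mono (χ≤1 ∘ P?)) (≤-reflexive (trans (sum-const m 1) (*-identityʳ m)))

♯-pick : (P? : Decidable Φ) (Q? : Decidable Ψ) → ♯ Q? < ♯ P? → ∃ λ i → Φ i × ¬ Ψ i
♯-pick P? Q? h with sum-∃< (χ ∘ Q?) (χ ∘ P?) h
... | i , lt with P? i | Q? i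
...   | yes p | no ¬q = i , p , ¬q
...   | yes p | yes q = contradiction lt (λ { (s≤s ()) })
...   | no _ | yes _ = contradiction lt (λ ())
...   | no _ | no _ = contradiction lt (λ ())

♯-empty : (P? : Decidable Φ) → (∀ i → ¬ Φ i) → ♯ P? ≡ 0
♯-empty {m} P? h = trans (sum-cong-≗ λ i → χ-no (P? i) (h i)) (trans (sum-const m 0) (*-zeroʳ m))

♯-unique : (P? : Decidable Φ) → (∀ i j → Φ i → Φ j → i ≡ j) → ♯ P? ≤ 1
♯-unique {zero} P? h = z≤n
♯-unique {suc m} P? h with P? zero
... | yes p = ≤-reflexive (cong suc (♯-empty (P? ∘ suc) λ i q → Fin.0≢1+n (h _ _ p q)))
... | no _ = ♯-unique (P? ∘ suc) λ i j p q → Fin.suc-injective (h _ _ p q)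

♯-∃ : (P? : Decidable Φ) → 0 < ♯ P? → ∃ Φ
♯-∃ {m} P? h with any? P?
... | yes p = p
... | no ¬p = contradiction (♯-empty P? λ i p → ¬p (i , p)) (m<n⇒n≢0 h)

_≟ₘ_ : ∀ {v} (x y : Maybe (Fin v)) → Dec (x ≡ y)
_≟ₘ_ = Data.Maybe.Properties.≡-dec Fin._≟_


χ-disjoint : (a : Dec X) (b : Dec Y) (c : Dec Z) → (X → Z) → (Y → Z) → (X → ¬ Y) → χ a + χ b ≤ χ c
χ-disjoint (yes x) (yes y) c f g h = contradiction y (h x)
χ-disjoint (yes x) (no _) c f g h = ≤-reflexive (sym (χ-yes c (f x)))
χ-disjoint (no _) b c f g h = χ-mono b c g

♯-disjoint : (P? : Decidable Φ) (Q? : Decidable Ψ) (R? : Decidable Θ) →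
  (∀ i → Φ i → Θ i) → (∀ i → Ψ i → Θ i) → (∀ i → Φ i → ¬ Ψ i) → ♯ P? + ♯ Q? ≤ ♯ R?
♯-disjoint P? Q? R? f g h = ≤-trans (≤-reflexive (sym (∑-distrib-+ (χ ∘ P?) (χ ∘ Q?))))
  (sum-mono λ i → χ-disjoint (P? i) (Q? i) (R? i) (f i) (g i) (h i))

♯-∪ : (P? : Decidable Φ) (Q? : Decidable Ψ) {a b : ℕ} → ♯ P? ≤ a → ♯ Q? ≤ b → ♯ (λ i → P? i ⊎-dec Q? i) ≤ a + b
♯-∪ P? Q? h h′ = ≤-trans (♯-⊎ (λ i → P? i ⊎-dec Q? i) P? Q? λ _ → id) (+-mono-≤ h h′)

♯-≟ : (i : Fin m) → ♯ (Fin._≟ i) ≤ 1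
♯-≟ i = ♯-unique (Fin._≟ i) λ { _ _ refl refl → refl }

-- Counting in weight matrices and among clashing labels

module Surplus {m} {S : Pred (Fin m) 0ℓ} (S? : Decidable S) (w : Fin m → Fin m → ℕ) (A : ℕ)
  (w≤2 : ∀ c d → w c d ≤ 2) (w-out : ∀ c d → ¬ S c → w c d ≡ 0)
  (rows : ∀ c → S c → m + A ≤ sum (w c))
  (cols : ∀ d → ¬ S d → sum (λ c → w c d) ≤ ♯ S?)
  where

  Bad : Fin m → Pred (Fin m) 0ℓ
  Bad d c = S d × S c × w c d ≡ 2 × 1 ≤ w d c

  Bad? : ∀ d → Decidable (Bad d)
  Bad? d c = S? d ×-dec S? c ×-dec w c d ≟ 2 ×-dec 1 ≤? w d c

  private
    q r B V : ℕ
    q = ♯ S?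
    r = ♯ (¬? ∘ S?)
    s : Fin m → ℕ
    s = χ ∘ S?
    v : Fin m → Fin m → ℕ
    v c d = w c d * s d
    B = sum λ d → ♯ (Bad? d)
    V = sum λ c → sum λ d → v c d

    r+q≡m : r + q ≡ m
    r+q≡m = trans (sym (∑-distrib-+ (χ ∘ ¬? ∘ S?) s))
      (trans (sum-cong-≗ one) (trans (sum-const m 1) (*-identityʳ m)))
      where
      one : ∀ d → χ (¬? (S? d)) + s d ≡ 1
      one d with S? d
      ... | yes _ = refl
      ... | no _ = refl

    total : q * (m + A) ≤ sum (λ c → sum (w c))
    total = ≤-trans (≤-reflexive (*-distribʳ-sum (m + A) s)) (sum-mono row)
      where
      row : ∀ c → s c * (m + A) ≤ sum (w c)
      row c with S? c
      ... | yes p = ≤-trans (≤-reflexive (*-identityˡ _)) (rows c p)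
      ... | no _ = z≤n

    -- The columns outside `S` are bounded by `q` each, so cutting the matrix down to its `S` by `S`
    -- block loses at most `r * q`.
    inside : sum (λ c → sum (w c)) ≤ V + r * q
    inside = begin
      sum (λ c → sum (w c))                              ≡⟨ ∑-comm w ⟩
      sum (λ d → sum λ c → w c d)                        ≤⟨ sum-mono col ⟩
      sum (λ d → sum (λ c → v c d) + χ (¬? (S? d)) * q)  ≡⟨ ∑-distrib-+ (λ d → sum λ c → v c d) (λ d → χ (¬? (S? d)) * q) ⟩
      sum (λ d → sum λ c → v c d) + sum (λ d → χ (¬? (S? d)) * q)
        ≡⟨ cong₂ _+_ (sym (∑-comm v)) (sym (*-distribʳ-sum q (χ ∘ ¬? ∘ S?))) ⟩
      V + r * q ∎
      where
      open ≤-Reasoning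
      col : ∀ d → sum (λ c → w c d) ≤ sum (λ c → v c d) + χ (¬? (S? d)) * q
      col d with S? d
      ... | yes _ = ≤-trans (≤-reflexive (sum-cong-≗ λ c → sym (*-identityʳ (w c d)))) (m≤m+n _ _)
      ... | no ¬p = ≤-trans (cols d ¬p) (≤-trans (≤-reflexive (sym (*-identityˡ q))) (m≤n+m _ (sum λ c → w c d * 0)))

    -- Two entries that are at most 2 have a sum above 2 only if one equals 2 and the other is
    -- positive. The excess over 2 is then the number of bad orders of the pair.
    pair : ∀ c d → v c d + v d c ≤ 2 * (s c * s d) + (χ (Bad? d c) + χ (Bad? c d))
    pair c d with S? c | S? d
    ... | no ¬p | no _ rewrite w-out c d ¬p | *-zeroʳ (w d c) = z≤n
    ... | no ¬p | yes _ rewrite w-out c d ¬p | *-zeroʳ (w d c) = z≤n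
    ... | yes _ | no ¬p rewrite w-out d c ¬p | *-zeroʳ (w c d) = z≤n
    ... | yes _ | yes _ with w c d | w d c | w≤2 c d | w≤2 d c
    ...   | 0 | 0 | _ | _ = z≤n
    ...   | 0 | 1 | _ | _ = s≤s z≤n
    ...   | 0 | 2 | _ | _ = ≤-refl
    ...   | 1 | 0 | _ | _ = s≤s z≤n
    ...   | 1 | 1 | _ | _ = ≤-refl
    ...   | 1 | 2 | _ | _ = ≤-refl
    ...   | 2 | 0 | _ | _ = ≤-refl
    ...   | 2 | 1 | _ | _ = ≤-refl
    ...   | 2 | 2 | _ | _ = ≤-refl
    ...   | suc (suc (suc _)) | _ | s≤s (s≤s ()) | _
    ...   | 0 | suc (suc (suc _)) | _ | s≤s (s≤s ())
    ...   | 1 | suc (suc (suc _)) | _ | s≤s (s≤s ())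
    ...   | 2 | suc (suc (suc _)) | _ | s≤s (s≤s ())

    sum² : (f g : Fin m → Fin m → ℕ) →
      sum (λ c → sum λ d → f c d + g c d) ≡ sum (λ c → sum (f c)) + sum (λ c → sum (g c))
    sum² f g = trans (sum-cong-≗ λ c → ∑-distrib-+ (f c) (g c)) (∑-distrib-+ (sum ∘ f) (sum ∘ g))

    square : sum (λ c → sum λ d → 2 * (s c * s d)) ≡ 2 * (q * q)
    square = begin
      sum (λ c → sum λ d → 2 * (s c * s d))    ≡⟨ sum-cong-≗ (λ c → sym (*-distribˡ-sum 2 (λ d → s c * s d))) ⟩
      sum (λ c → 2 * sum λ d → s c * s d)      ≡⟨ sym (*-distribˡ-sum 2 (λ c → sum λ d → s c * s d)) ⟩
      2 * sum (λ c → sum λ d → s c * s d)      ≡⟨ cong (2 *_) (sum-cong-≗ λ c → sym (*-distribˡ-sum (s c) s)) ⟩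
      2 * sum (λ c → s c * q)                  ≡⟨ cong (2 *_) (sym (*-distribʳ-sum q s)) ⟩
      2 * (q * q) ∎
      where open ≡-Reasoning

    double : V + V ≤ 2 * (q * q) + (B + B)
    double = begin
      V + V ≡⟨ cong (V +_) (∑-comm v) ⟩
      V + sum (λ d → sum λ c → v c d) ≡⟨ sym (sum² v (flip v)) ⟩
      sum (λ c → sum λ d → v c d + v d c) ≤⟨ sum-mono (λ c → sum-mono (pair c)) ⟩
      sum (λ c → sum λ d → 2 * (s c * s d) + (χ (Bad? d c) + χ (Bad? c d)))
        ≡⟨ sum² (λ c d → 2 * (s c * s d)) (λ c d → χ (Bad? d c) + χ (Bad? c d)) ⟩
      sum (λ c → sum λ d → 2 * (s c * s d)) + sum (λ c → sum λ d → χ (Bad? d c) + χ (Bad? c d))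
        ≡⟨ cong₂ _+_ square (sum² (λ c d → χ (Bad? d c)) (λ c d → χ (Bad? c d))) ⟩
      2 * (q * q) + (sum (λ c → sum λ d → χ (Bad? d c)) + B)
        ≡⟨ cong (λ x → 2 * (q * q) + (x + B)) (∑-comm (λ c d → χ (Bad? d c))) ⟩
      2 * (q * q) + (B + B) ∎
      where open ≤-Reasoning

    -- As `m` is `r + q`, the bounds `total` and `inside` leave at least `q * (q + A)` for `V`.
    -- Comparing twice this with `double` cancels `2 * (q * q)`.
    qA≤B : q * A ≤ B
    qA≤B = *-cancelˡ-≤ 2 (≤-cancel (2 * (q * q) + 2 * (r * q) + (V + V))
      (lhs q r A V) (rhs q r V B)
      (+-mono-≤ (+-mono-≤ tot tot) double))
      where
      tot : q * (r + q + A) ≤ V + r * q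
      tot = ≤-trans (≤-reflexive (cong (λ x → q * (x + A)) r+q≡m)) (≤-trans total inside)
      lhs : ∀ q r A V → (q * (r + q + A) + q * (r + q + A)) + (V + V)
        ≡ 2 * (q * A) + (2 * (q * q) + 2 * (r * q) + (V + V))
      lhs = solve-∀
      rhs : ∀ q r V B → ((V + r * q) + (V + r * q)) + (2 * (q * q) + (B + B))
        ≡ 2 * B + (2 * (q * q) + 2 * (r * q) + (V + V))
      rhs = solve-∀

  -- By `qA≤B` the average of `♯ (Bad? d)` over `S` is at least `A`. If each `d` in `S` fell short
  -- by at least one, then `q + B ≤ q * A ≤ B`, which is absurd since `S` is inhabited.
  surplus : ∃ S → ∃ λ d → A ≤ ♯ (Bad? d)
  surplus (c , p) with any? (λ d → A ≤? ♯ (Bad? d))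
  ... | yes h = h
  ... | no ¬h = contradiction (+-cancelʳ-≤ B q 0 (≤-trans few qA≤B)) (<⇒≱ q>0)
    where
    q>0 : 0 < q
    q>0 = ≤-trans (≤-reflexive (sym (χ-yes (S? c) p))) (term≤sum s c)
    few′ : ∀ d (p? : Dec (S d)) → χ p? + ♯ (Bad? d) ≤ χ p? * A
    few′ d (yes _) = ≤-trans (≰⇒> λ h → ¬h (d , h)) (≤-reflexive (sym (*-identityˡ A)))
    few′ d (no ¬p) = ≤-reflexive (♯-empty (Bad? d) λ _ b → ¬p (proj₁ b))
    few : q + B ≤ q * A
    few = ≤-trans (≤-reflexive (sym (∑-distrib-+ s (λ d → ♯ (Bad? d)))))
      (≤-trans (sum-mono λ d → few′ d (S? d)) (≤-reflexive (sym (*-distribʳ-sum A s))))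

-- Two elements of Q are taken with the same entering label ζ: as ζ differs from
-- the closing label of the second one, the pair of them cannot clash.
entering-closing-clash : ∀ {m v g} {Q : Pred (Fin m) 0ℓ} (Q? : Decidable Q)
  (enter close via : Fin m → Maybe (Fin v)) →
  (∀ c → Q c → enter c ≢ close c) →
  (∀ c c′ → Q c → Q c′ → via c ≡ via c′ → c ≡ c′) →
  {Ok : Fin m → Pred (Fin m) 0ℓ} (Ok? : ∀ c₂ → Decidable (Ok c₂)) →
  (∀ c₂ → Q c₂ → ♯ (λ c₁ → Q? c₁ ×-dec ¬? (Ok? c₂ c₁)) ≤ g) →
  (∀ c₁ c₂ → Q c₁ → Q c₂ → c₁ ≢ c₂ → Ok c₂ c₁ → enter c₁ ≡ close c₂ ⊎ enter c₁ ≡ via c₂) →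
  ♯ Q? ≤ 3 * (g + 1)
entering-closing-clash {m} {v} {g} {Q} Q? enter close via e≢c via-inj {Ok} Ok? rare clash with any? Q?
... | no ¬q = ≤-trans (≤-reflexive (♯-empty Q? λ i q → ¬q (i , q))) z≤n
-- For one fixed `c₂`, at most `g` elements fail `Ok` and one is `c₂` itself. All others enter by
-- `close c₂` or by `via c₂`, and each of these two classes has at most `g + 1` elements.
... | yes (c₂ , q₂) = ≤-trans (rest-many Q? (λ _ → id) c₂ q₂) (≤-trans (+-monoʳ-≤ (g + 1)
    (≤-trans (♯-⊎ (λ c₁ → Q? c₁ ×-dec Rest? c₂ c₁) (Class? (close c₂)) (Class? (via c₂)) split)
      (+-mono-≤ (class-small _) (class-small _))))
    (≤-reflexive (cong (λ x → (g + 1) + ((g + 1) + x)) (sym (+-identityʳ _)))))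
  where
  Rest : Fin m → Pred (Fin m) 0ℓ
  Rest c₂ c₁ = Q c₁ × Ok c₂ c₁ × c₁ ≢ c₂
  Rest? : ∀ c₂ → Decidable (Rest c₂)
  Rest? c₂ c₁ = Q? c₁ ×-dec Ok? c₂ c₁ ×-dec ¬? (c₁ Fin.≟ c₂)

  rest-many : ∀ {P : Pred (Fin m) 0ℓ} (P? : Decidable P) → (∀ c → P c → Q c) →
    ∀ c₂ → Q c₂ → ♯ P? ≤ (g + 1) + ♯ (λ c₁ → P? c₁ ×-dec Rest? c₂ c₁)
  rest-many {P} P? P⊆Q c₂ q₂ = ≤-trans
    (♯-⊎ P? (λ c₁ → (Q? c₁ ×-dec ¬? (Ok? c₂ c₁)) ⊎-dec c₁ Fin.≟ c₂) (λ c₁ → P? c₁ ×-dec Rest? c₂ c₁) split)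
    (+-monoˡ-≤ (♯ λ c₁ → P? c₁ ×-dec Rest? c₂ c₁) (≤-trans (♯-⊎ (λ c₁ → (Q? c₁ ×-dec ¬? (Ok? c₂ c₁)) ⊎-dec c₁ Fin.≟ c₂) (λ c₁ → Q? c₁ ×-dec ¬? (Ok? c₂ c₁)) (Fin._≟ c₂) λ _ → id)
      (+-mono-≤ (rare c₂ q₂) (♯-≟ c₂))))
    where
    split : ∀ c₁ → P c₁ → ((Q c₁ × ¬ Ok c₂ c₁) ⊎ c₁ ≡ c₂) ⊎ (P c₁ × Rest c₂ c₁)
    split c₁ p with Ok? c₂ c₁ | c₁ Fin.≟ c₂
    ... | yes o | yes e = inj₁ (inj₂ e)
    ... | yes o | no ne = inj₂ (p , P⊆Q c₁ p , o , ne)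
    ... | no ¬o | _ = inj₁ (inj₁ (P⊆Q c₁ p , ¬o))

  Class : Maybe (Fin v) → Pred (Fin m) 0ℓ
  Class ζ c = Q c × enter c ≡ ζ
  Class? : ∀ ζ → Decidable (Class ζ)
  Class? ζ c = Q? c ×-dec enter c ≟ₘ ζ

  class-small : ∀ ζ → ♯ (Class? ζ) ≤ g + 1
  class-small ζ = ≮⇒≥ λ lt →
    let (c₂ , (q₂ , e₂) , ¬v₂) = second lt
        (c₁ , (_ , e₁) , q₁ , o₁ , ne) = first lt c₂ q₂
    in finish q₁ q₂ e₁ e₂ ¬v₂ (clash c₁ c₂ q₁ q₂ ne o₁)
    where
    Via? : Decidable (λ c → Q c × via c ≡ ζ)
    Via? c = Q? c ×-dec via c ≟ₘ ζ
    -- The class has at least two elements, and by `via-inj` at most one of them has `via` equal to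
    -- `ζ`.
    second : g + 1 < ♯ (Class? ζ) → ∃ λ c → Class ζ c × ¬ (Q c × via c ≡ ζ)
    second lt = ♯-pick (Class? ζ) Via? (≤-<-trans
      (♯-unique Via? λ i j p p′ → via-inj i j (proj₁ p) (proj₁ p′) (trans (proj₂ p) (sym (proj₂ p′))))
      (≤-trans (s≤s (m≤n+m 1 g)) lt))
    first : g + 1 < ♯ (Class? ζ) → ∀ c₂ → Q c₂ → ∃ λ c₁ → Class ζ c₁ × Rest c₂ c₁
    first lt c₂ q₂ = ♯-∃ (λ c₁ → Class? ζ c₁ ×-dec Rest? c₂ c₁) (+-cancelˡ-< (g + 1) 0 _
      (≤-trans (s≤s (≤-reflexive (+-identityʳ (g + 1)))) (≤-trans lt (rest-many (Class? ζ) (λ _ → proj₁) c₂ q₂))))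
    finish : ∀ {c₁ c₂} → Q c₁ → Q c₂ → enter c₁ ≡ ζ → enter c₂ ≡ ζ → ¬ (Q c₂ × via c₂ ≡ ζ) →
      enter c₁ ≡ close c₂ ⊎ enter c₁ ≡ via c₂ → ⊥
    finish q₁ q₂ e₁ e₂ ¬v (inj₁ h) = e≢c _ q₂ (trans e₂ (trans (sym e₁) h))
    finish q₁ q₂ e₁ e₂ ¬v (inj₂ h) = ¬v (q₂ , trans (sym h) e₁)

  split : ∀ c₁ → Q c₁ × Rest c₂ c₁ → Class (close c₂) c₁ ⊎ Class (via c₂) c₁
  split c₁ (q₁ , _ , o , ne) with clash c₁ c₂ q₁ q₂ ne o
  ... | inj₁ h = inj₁ (q₁ , h)
  ... | inj₂ h = inj₂ (q₁ , h)

-- Rainbow matchings and switching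

module _ {v : ℕ} where
  open import Data.List.Membership.DecPropositional (Fin._≟_ {v}) public using (_∈?_)

♯-∈≤length : ∀ {v} (xs : List (Fin v)) → ♯ (_∈? xs) ≤ length xs
♯-∈≤length {v} [] = ≤-reflexive (♯-empty {Φ = λ (x : Fin v) → x ∈ []} (_∈? []) λ _ ())
♯-∈≤length (x ∷ xs) = ≤-trans (♯-⊎ (_∈? x ∷ xs) (Fin._≟ x) (_∈? xs) λ { _ (here e) → inj₁ e ; _ (there p) → inj₂ p })
  (+-mono-≤ (♯-≟ x) (♯-∈≤length xs))

length≤♯-∈ : ∀ {v} {xs : List (Fin v)} → Unique xs → length xs ≤ ♯ (_∈? xs)
length≤♯-∈ [] = z≤n
length≤♯-∈ {v} {x ∷ xs} (x∉ ∷ u) = ≤-trans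
  (+-mono-≤ (≤-trans (≤-reflexive (sym (χ-yes (x Fin.≟ x) refl))) (term≤sum (λ y → χ (y Fin.≟ x)) x)) (length≤♯-∈ u))
  (♯-disjoint (Fin._≟ x) (_∈? xs) (_∈? x ∷ xs) (λ _ → here) (λ _ → there)
    λ { _ refl q → contradiction refl (All.lookup x∉ q) })

Row : ℕ → ℕ → Set
Row m v = Fin m → Bool → Maybe (Fin v)

⟦_⟧ : {A : Set} → Maybe A → ℕ
⟦ just _ ⟧ = 1
⟦ nothing ⟧ = 0

weight : ∀ {m v} → Row m v → Fin m → ℕ
weight τ i = ⟦ τ i true ⟧ + ⟦ τ i false ⟧

module Graph {n : ℕ} (G : ColouredMultigraph n) where
  open ColouredMultigraph G

  IsMatching : ∀ {k} → (Fin k → Fin E) → Set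
  IsMatching μ = ∀ i j → i ≢ j → VertexDisjoint G (μ i) (μ j) × colour (μ i) ≢ colour (μ j)

  Free : ∀ {k} → (Fin k → Fin E) → Fin V → Set
  Free μ v = ∀ i → ¬ Incident G (μ i) v

  Missing : ∀ {k} → (Fin k → Fin E) → Fin n → Set
  Missing μ γ = ∀ i → colour (μ i) ≢ γ

  incident? : ∀ e u → Dec (Incident G e u)
  incident? e u = end₁ e Fin.≟ u ⊎-dec end₂ e Fin.≟ u

  free? : ∀ {k} (μ : Fin k → Fin E) → Decidable (Free μ)
  free? μ v = all? λ i → ¬? (incident? (μ i) v)

  ¬free⇒incident : ∀ {k} (μ : Fin k → Fin E) {v} → ¬ Free μ v → ∃ λ i → Incident G (μ i) v
  ¬free⇒incident μ {v} ¬f with any? (λ i → incident? (μ i) v)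
  ... | yes h = h
  ... | no ¬h = contradiction (λ i inc → ¬h (i , inc)) ¬f

  joins? : ∀ e u v → Dec (Joins G e u v)
  joins? e u v = (end₁ e Fin.≟ u ×-dec end₂ e Fin.≟ v) ⊎-dec (end₁ e Fin.≟ v ×-dec end₂ e Fin.≟ u)

  adj? : ∀ γ u v → Dec (Adj G γ u v)
  adj? γ u v = any? λ e → colour e Fin.≟ γ ×-dec joins? e u v

  isMatching? : ∀ {k} → Decidable (IsMatching {k})
  isMatching? μ = all? λ i → all? λ j → ¬? (i Fin.≟ j) →-dec
    ((all? λ u → incident? (μ i) u →-dec ¬? (incident? (μ j) u)) ×-dec ¬? (colour (μ i) Fin.≟ colour (μ j)))

  -- The maps from `Fin k` to `Fin E` are finitely many, coded by `funToFin`. Decoding gives the map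
  -- back only pointwise, so the conditions are transported for one pair of edges at a time.
  matching? : ∀ k → Dec (∃ (IsMatching {k}))
  matching? k = map′ (λ (c , h) → finToFun c , h)
    (λ (μ , h) → funToFin μ , λ i j ne →
      subst₂ (λ e f → VertexDisjoint G e f × colour e ≢ colour f)
        (sym (Fin.finToFun-funToFin μ i)) (sym (Fin.finToFun-funToFin μ j)) (h i j ne))
    (any? λ c → isMatching? (finToFun {E} {k} c))

  joins-incident : ∀ {e p q r} → Joins G e p q → Incident G e r → r ≡ p ⊎ r ≡ q
  joins-incident (inj₁ (a , b)) (inj₁ c) = inj₁ (trans (sym c) a)
  joins-incident (inj₁ (a , b)) (inj₂ c) = inj₂ (trans (sym c) b)
  joins-incident (inj₂ (a , b)) (inj₁ c) = inj₂ (trans (sym c) a)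
  joins-incident (inj₂ (a , b)) (inj₂ c) = inj₁ (trans (sym c) b)

  adj-sym : ∀ {γ u v} → Adj G γ u v → Adj G γ v u
  adj-sym (e , c , j) = e , c , Data.Sum.swap j

  adj-inColour : ∀ {γ u v} → Adj G γ u v → InColour G γ u
  adj-inColour (e , c , inj₁ (a , _)) = e , c , inj₁ a
  adj-inColour (e , c , inj₂ (_ , b)) = e , c , inj₂ b

  augment : ∀ {k γ p q} {μ : Fin k → Fin E} → IsMatching μ → Missing μ γ → Adj G γ p q →
    Free μ p → Free μ q → ∃ (IsMatching {suc k})
  augment {μ = μ} M γ∉ (ε , refl , join) p∉ q∉ = ε ∷ᶠ μ , ok
    where
    fresh : ∀ j → VertexDisjoint G ε (μ j)
    fresh j r inc with joins-incident join inc
    ... | inj₁ refl = p∉ j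
    ... | inj₂ refl = q∉ j
    ok : IsMatching (ε ∷ᶠ μ)
    ok zero zero ne = contradiction refl ne
    ok zero (suc j) ne = fresh j , γ∉ j ∘ sym
    ok (suc i) zero ne = (λ r a b → fresh i r b a) , γ∉ i
    ok (suc i) (suc j) ne = M i j (ne ∘ cong suc)

  -- The new edge has the missing colour and meets `μ` only at `p`, which lies on the discarded
  -- edge. The last component asks nothing of `v` concerning edge `d`, so that it also applies to
  -- the other end of the discarded edge.
  switch : ∀ {k γ p q} {μ : Fin k → Fin E} → IsMatching μ → Missing μ γ → ∀ d → Adj G γ p q →
    Incident G (μ d) p → Free μ q →
    ∃ λ (μ′ : Fin k → Fin E) → IsMatching μ′ × Missing μ′ (colour (μ d)) × (∀ i → i ≢ d → μ′ i ≡ μ i)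
      × (∀ v → v ≢ p → v ≢ q → (∀ i → i ≢ d → ¬ Incident G (μ i) v) → Free μ′ v)
  switch {k} {γ} {p} {q} {μ} M γ∉ d (ε , refl , join) p∈ q∉ = μ′ , ok , missing , same , free
    where
    μ′ : Fin k → Fin E
    μ′ = updateAt μ d (const ε)
    new : μ′ d ≡ ε
    new = updateAt-updates d μ
    same : ∀ i → i ≢ d → μ′ i ≡ μ i
    same i ne = updateAt-minimal i d μ ne
    fresh : ∀ j → j ≢ d → VertexDisjoint G ε (μ j)
    fresh j ne r inc with joins-incident join inc
    ... | inj₁ refl = proj₁ (M d j (ne ∘ sym)) p p∈
    ... | inj₂ refl = q∉ j
    ok : IsMatching μ′
    ok i j ne with i Fin.≟ d | j Fin.≟ d
    ... | yes refl | yes refl = contradiction refl ne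
    ... | yes refl | no j≢ rewrite new | same j j≢ = fresh j j≢ , γ∉ j ∘ sym
    ... | no i≢ | yes refl rewrite new | same i i≢ = (λ r a b → fresh i i≢ r b a) , γ∉ i
    ... | no i≢ | no j≢ rewrite same i i≢ | same j j≢ = M i j ne
    missing : Missing μ′ (colour (μ d))
    missing i with i Fin.≟ d
    ... | yes refl rewrite new = γ∉ d ∘ sym
    ... | no i≢ rewrite same i i≢ = proj₂ (M i d i≢)
    free : ∀ v → v ≢ p → v ≢ q → (∀ i → i ≢ d → ¬ Incident G (μ i) v) → Free μ′ v
    free v v≢p v≢q h i with i Fin.≟ d
    ... | no i≢ rewrite same i i≢ = h i i≢
    ... | yes refl rewrite new = λ inc → Data.Sum.[ v≢p , v≢q ] (joins-incident join inc)

module Switching {n : ℕ} (G : ColouredMultigraph n) {m : ℕ} (μ₀ : Fin m → Fin (ColouredMultigraph.E G))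
  (M₀ : Graph.IsMatching G μ₀) (maximal : ¬ ∃ (Graph.IsMatching G {suc m}))
  where

  open ColouredMultigraph G
  open Graph G

  endOf : ∀ {k} → (Fin k → Fin E) → Fin k → Bool → Fin V
  endOf μ i true = end₁ (μ i)
  endOf μ i false = end₂ (μ i)

  endOf-incident : ∀ {k} (μ : Fin k → Fin E) i b → Incident G (μ i) (endOf μ i b)
  endOf-incident μ i true = inj₁ refl
  endOf-incident μ i false = inj₂ refl

  incident-endOf : ∀ {k} (μ : Fin k → Fin E) i {v} → Incident G (μ i) v → ∃ λ b → endOf μ i b ≡ v
  incident-endOf μ i (inj₁ e) = true , e
  incident-endOf μ i (inj₂ e) = false , e

  end : Fin m → Bool → Fin V
  end = endOf μ₀

  Outside : Fin V → Set
  Outside = Free μ₀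

  -- The rainbow matching μ misses the colour γ and arises from μ₀ by replacing
  -- the edges with index in P, using no outside vertices but those in W.
  record State (P : List (Fin m)) (W : List (Fin V)) (γ : Fin n) : Set where
    field
      μ        : Fin m → Fin E
      matching : IsMatching μ
      missing  : Missing μ γ
      same     : ∀ i → i ∉ P → μ i ≡ μ₀ i
      free     : ∀ v → Outside v → v ∉ W → Free μ v

    no-free-edge : ∀ {p q} → Adj G γ p q → Free μ p → ¬ Free μ q
    no-free-edge a p q = maximal (augment matching missing a p q)

  -- As `d ∉ P`, the edge being switched is still `μ₀ d`. The two extra facts serve `win`: the other
  -- end of `d` is freed, and `v` is the only free vertex lost.
  advance : ∀ {P W γ} (s : State P W γ) d b {v} → d ∉ P → Adj G γ (end d b) v → Outside v → v ∉ W →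
    Σ (State (d ∷ P) (v ∷ W) (colour (μ₀ d))) λ s′ →
      Free (State.μ s′) (end d (not b)) × (∀ {u} → Free (State.μ s) u → u ≢ v → Free (State.μ s′) u)
  advance {P} {W} {γ} s d b {v} d∉ a out v∉ = finish (switch matching missing d a inc (free v out v∉))
    where
    open State s
    inc : Incident G (μ d) (end d b)
    inc = subst (λ e → Incident G e (end d b)) (sym (same d d∉)) (endOf-incident μ₀ d b)
    covered : ∀ {u} i b′ → Outside u → u ≢ end i b′
    covered i b′ o refl = o i (endOf-incident μ₀ i b′)
    distinct : ∀ b → end d (not b) ≢ end d b
    distinct true e = loopless _ (sym e)
    distinct false e = loopless _ e
    finish : _ → _
    finish (μ′ , ok , miss , same′ , free′) = record
      { μ = μ′ ; matching = ok
      ; missing = subst (Missing μ′ ∘ colour) (same d d∉) miss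
      ; same = λ i i∉ → trans (same′ i (i∉ ∘ here)) (same i (i∉ ∘ there))
      ; free = λ u o u∉ → free′ u (covered d b o) (u∉ ∘ here) λ i _ → free u o (u∉ ∘ there) i
      } , (free′ _ (distinct b) (covered d (not b) out ∘ sym) λ i i≢d x →
        proj₁ (matching i d i≢d) _ x (subst (λ e → Incident G e _) (sym (same d d∉)) (endOf-incident μ₀ d (not b))))
      , λ {u} f u≢v → free′ u (λ { refl → f d inc }) u≢v λ i _ → f i

  start : ∀ {γ} → Missing μ₀ γ → State [] [] γ
  start miss = record { μ = μ₀ ; matching = M₀ ; missing = miss ; same = λ _ _ → refl ; free = λ _ o _ → o }

  -- The switches at `d` and `c₂` make the colour of `c₂` missing. The first frees `end d (not b)`,
  -- and the second keeps it free because the outside vertex `y` is no end of `d`. As `z` has not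
  -- been spent, the edge from there to `z` would augment the matching.
  win : ∀ {P W c₁ d c₂ b b′ x y z} → State P W (colour (μ₀ c₁)) → d ∉ P → c₂ ∉ d ∷ P →
    Adj G (colour (μ₀ c₁)) (end d b) x → Outside x → x ∉ W →
    Adj G (colour (μ₀ d)) (end c₂ b′) y → Outside y → y ∉ x ∷ W →
    Adj G (colour (μ₀ c₂)) (end d (not b)) z → Outside z → z ∉ y ∷ x ∷ W → ⊥
  win {d = d} {c₂} {b} {b′} s d∉ c₂∉ ax ox x∉ ay oy y∉ az oz z∉ with advance s d b d∉ ax ox x∉
  ... | s₁ , freed , _ with advance s₁ c₂ b′ c₂∉ ay oy y∉
  ...   | s₂ , _ , keep = State.no-free-edge s₂ az
    (keep freed λ { refl → oy d (endOf-incident μ₀ d (not b)) }) (State.free s₂ _ oz z∉)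

  -- Labelling the ends of matching edges by outside vertices

  Slot : Set
  Slot = Fin m × Bool

  _≟ₛ_ : (s t : Maybe Slot) → Dec (s ≡ t)
  _≟ₛ_ = Data.Maybe.Properties.≡-dec (≡-dec Fin._≟_ Data.Bool.Properties._≟_)

  -- `P` lists the edges switched on the way to `γ`, and `W` contains the outside vertices spent
  -- there, so each label is a possible next step of the alternating path.
  record IsRow (γ : Fin n) (P : List (Fin m)) (W : List (Fin V)) (τ : Row m V) : Set where
    field
      sound : ∀ i b {v} → τ i b ≡ just v → Outside v × v ∉ W × i ∉ P × Adj G γ (end i b) v
      injective : ∀ {i b j b′ v} → τ i b ≡ just v → τ j b′ ≡ just v → (i , b) ≡ (j , b′)

  outside? : Decidable Outside
  outside? = free? μ₀

  ♯-inside : ♯ (¬? ∘ outside?) ≤ 2 * m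
  ♯-inside = begin
    ♯ (¬? ∘ outside?) ≤⟨ sum-mono (λ v → one v (outside? v)) ⟩
    sum (λ v → sum λ i → χ (end i true Fin.≟ v) + χ (end i false Fin.≟ v)) ≡⟨ ∑-comm (λ v i → χ (end i true Fin.≟ v) + χ (end i false Fin.≟ v)) ⟩
    sum (λ i → sum λ v → χ (end i true Fin.≟ v) + χ (end i false Fin.≟ v)) ≤⟨ sum-mono two ⟩
    sum (λ (_ : Fin m) → 2) ≡⟨ trans (sum-const m 2) (*-comm m 2) ⟩
    2 * m ∎
    where
    open ≤-Reasoning
    one : ∀ v (o? : Dec (Outside v)) → χ (¬? o?) ≤ sum λ i → χ (end i true Fin.≟ v) + χ (end i false Fin.≟ v)
    one v (yes _) = z≤n
    one v (no ¬o) with ¬free⇒incident μ₀ ¬o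
    ... | i , inc = ≤-trans (split inc) (term≤sum (λ i → χ (end i true Fin.≟ v) + χ (end i false Fin.≟ v)) i)
      where
      split : Incident G (μ₀ i) v → 1 ≤ χ (end i true Fin.≟ v) + χ (end i false Fin.≟ v)
      split (inj₁ e) = ≤-trans (≤-reflexive (sym (χ-yes (end i true Fin.≟ v) e))) (m≤m+n _ _)
      split (inj₂ e) = ≤-trans (≤-reflexive (sym (χ-yes (end i false Fin.≟ v) e))) (m≤n+m _ _)
    two : ∀ i → sum (λ v → χ (end i true Fin.≟ v) + χ (end i false Fin.≟ v)) ≤ 2
    two i = ≤-trans (≤-reflexive (∑-distrib-+ (λ v → χ (end i true Fin.≟ v)) (λ v → χ (end i false Fin.≟ v))))
      (+-mono-≤ (♯-unique (end i true Fin.≟_) λ { _ _ refl refl → refl }) (♯-unique (end i false Fin.≟_) λ { _ _ refl refl → refl }))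

  module _ {P W γ} (s : State P W γ) (W′ : List (Fin V)) (W⊆W′ : W ⊆ W′)
    (cliques : DisjointUnionOfNontrivialCliques G γ)
    (xs : List (Fin V)) (xs-unique : Unique xs) (xs-γ : All (InColour G γ) xs) where

    open State s

    private
      part : Fin V → ℕ
      part = proj₁ (proj₂ cliques)
      adj⇒part : ∀ {u v} → u ≢ v → Adj G γ u v → part u ≡ part v
      adj⇒part ne a = Equivalence.to (proj₁ (proj₂ (proj₂ cliques)) _ _ (adj-inColour a) (adj-inColour (adj-sym a)) ne) a
      part⇒adj : ∀ {u v} → u ≢ v → InColour G γ u → InColour G γ v → part u ≡ part v → Adj G γ u v
      part⇒adj ne a b = Equivalence.from (proj₁ (proj₂ (proj₂ cliques)) _ _ a b ne)

      HasSlot : Fin V → Fin m → Bool → Set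
      HasSlot v i b = Adj G γ (endOf μ i b) v

      slot? : ∀ v → Dec (∃ λ i → HasSlot v i true ⊎ HasSlot v i false)
      slot? v = any? λ i → adj? γ (endOf μ i true) v ⊎-dec adj? γ (endOf μ i false) v

      slotOf : ∀ {v} → Dec (∃ λ i → HasSlot v i true ⊎ HasSlot v i false) → Maybe Slot
      slotOf (yes (i , inj₁ _)) = just (i , true)
      slotOf (yes (i , inj₂ _)) = just (i , false)
      slotOf (no _) = nothing

      slotOf-sound : ∀ {v} (d : Dec (∃ λ i → HasSlot v i true ⊎ HasSlot v i false)) {i b} → slotOf d ≡ just (i , b) → HasSlot v i b
      slotOf-sound (yes (_ , inj₁ a)) refl = a
      slotOf-sound (yes (_ , inj₂ a)) refl = a

      slotOf-total : ∀ {v} (d : Dec (∃ λ i → HasSlot v i true ⊎ HasSlot v i false)) → ∀ i b → HasSlot v i b → ∃ λ t → slotOf d ≡ just t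
      slotOf-total (yes (_ , inj₁ _)) _ _ _ = _ , refl
      slotOf-total (yes (_ , inj₂ _)) _ _ _ = _ , refl
      slotOf-total (no ¬h) i true a = contradiction (i , inj₁ a) ¬h
      slotOf-total (no ¬h) i false a = contradiction (i , inj₂ a) ¬h

      slot : Fin V → Maybe Slot
      slot v = slotOf (slot? v)

      Good : Fin V → Set
      Good v = v ∈ xs × Outside v × v ∉ W′

      good? : Decidable Good
      good? v = v ∈? xs ×-dec outside? v ×-dec ¬? (v ∈? W′)

      good-free : ∀ {v} → Good v → Free μ v
      good-free (_ , o , v∉) = free _ o (v∉ ∘ W⊆W′)

      -- The clique of `v` is nontrivial and supplies a neighbour `u`. If `u` were free, the edge
      -- between them would augment the matching, so `u` is an end of an edge of `μ`.
      good-slot : ∀ {v} → Good v → ∃ λ t → slot v ≡ just t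
      good-slot {v} g = found (proj₂ (proj₂ (proj₂ cliques)) v inγ)
        where
        inγ : InColour G γ v
        inγ = All.lookup xs-γ (proj₁ g)
        found : (∃ λ u → u ≢ v × InColour G γ u × part u ≡ part v) → ∃ λ t → slot v ≡ just t
        found (u , u≢v , inγ′ , eq) with free? μ u
        ... | yes f = contradiction f (no-free-edge (adj-sym (part⇒adj u≢v inγ′ inγ eq)) (good-free g))
        ... | no ¬f with ¬free⇒incident μ ¬f
        ...   | i , inc with incident-endOf μ i inc
        ...     | b , refl = slotOf-total (slot? v) i b (part⇒adj u≢v inγ′ inγ eq)

      -- Two outside vertices attached to the same end lie in one clique, so they
      -- span an edge that augments the matching.
      slot-unique : ∀ {v v′ t} → Good v → Good v′ → slot v ≡ just t → slot v′ ≡ just t → v ≡ v′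
      slot-unique {v} {v′} {i , b} g g′ e e′ with v Fin.≟ v′
      ... | yes p = p
      ... | no ne = contradiction (good-free g′) (no-free-edge
              (part⇒adj ne (adj-inColour (adj-sym a)) (adj-inColour (adj-sym a′)) (trans (sym (adj⇒part (away g) a)) (adj⇒part (away g′) a′)))
              (good-free g))
        where
        a : HasSlot v i b
        a = slotOf-sound (slot? v) e
        a′ : HasSlot v′ i b
        a′ = slotOf-sound (slot? v′) e′
        away : ∀ {u} → Good u → endOf μ i b ≢ u
        away g refl = good-free g i (endOf-incident μ i b)

      At : Slot → Fin V → Set
      At t v = Good v × slot v ≡ just t

      at? : ∀ t → Decidable (At t)
      at? t v = good? v ×-dec slot v ≟ₛ just t

      label : ∀ {t} → Dec (∃ (At t)) → Maybe (Fin V)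
      label (yes (v , _)) = just v
      label (no _) = nothing

      label-sound : ∀ {t} (d : Dec (∃ (At t))) {v} → label d ≡ just v → At t v
      label-sound (yes (_ , a)) refl = a

      ♯-at : ∀ t (d : Dec (∃ (At t))) → ♯ (at? t) ≤ ⟦ label d ⟧
      ♯-at t (yes _) = ♯-unique (at? t) λ i j (g , e) (g′ , e′) → slot-unique g g′ e e′
      ♯-at t (no ¬h) = ≤-reflexive (♯-empty (at? t) λ v a → ¬h (v , a))

      τ′ : Row m V
      τ′ i b = label (any? (at? (i , b)))

      ♯-good : ♯ good? ≤ sum (weight τ′)
      ♯-good = begin
        ♯ good? ≤⟨ sum-mono (λ v → one v (good? v)) ⟩
        sum (λ v → sum λ i → χ (at? (i , true) v) + χ (at? (i , false) v)) ≡⟨ ∑-comm (λ v i → χ (at? (i , true) v) + χ (at? (i , false) v)) ⟩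
        sum (λ i → sum λ v → χ (at? (i , true) v) + χ (at? (i , false) v)) ≤⟨ sum-mono two ⟩
        sum (weight τ′) ∎
        where
        open ≤-Reasoning
        one : ∀ v (g? : Dec (Good v)) → χ g? ≤ sum λ i → χ (at? (i , true) v) + χ (at? (i , false) v)
        one v (no _) = z≤n
        one v (yes g) with good-slot g
        ... | (i , true) , e = ≤-trans (≤-trans (≤-reflexive (sym (χ-yes (at? (i , true) v) (g , e)))) (m≤m+n _ _))
                (term≤sum (λ i → χ (at? (i , true) v) + χ (at? (i , false) v)) i)
        ... | (i , false) , e = ≤-trans (≤-trans (≤-reflexive (sym (χ-yes (at? (i , false) v) (g , e)))) (m≤n+m _ _))
                (term≤sum (λ i → χ (at? (i , true) v) + χ (at? (i , false) v)) i)
        two : ∀ i → sum (λ v → χ (at? (i , true) v) + χ (at? (i , false) v)) ≤ weight τ′ i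
        two i = ≤-trans (≤-reflexive (∑-distrib-+ (χ ∘ at? (i , true)) (χ ∘ at? (i , false))))
          (+-mono-≤ (♯-at (i , true) (any? (at? (i , true)))) (♯-at (i , false) (any? (at? (i , false)))))

      xs≤good : length xs ≤ ♯ good? + (2 * m + length W′)
      xs≤good = begin
        length xs ≤⟨ length≤♯-∈ xs-unique ⟩
        ♯ (_∈? xs) ≤⟨ ♯-⊎ (_∈? xs) good? (λ v → ¬? (outside? v) ⊎-dec v ∈? W′) split ⟩
        ♯ good? + ♯ (λ v → ¬? (outside? v) ⊎-dec v ∈? W′) ≤⟨ +-monoʳ-≤ (♯ good?) (♯-⊎ (λ v → ¬? (outside? v) ⊎-dec v ∈? W′) (¬? ∘ outside?) (_∈? W′) λ _ → id) ⟩
        ♯ good? + (♯ (¬? ∘ outside?) + ♯ (_∈? W′)) ≤⟨ +-monoʳ-≤ (♯ good?) (+-mono-≤ ♯-inside (♯-∈≤length W′)) ⟩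
        ♯ good? + (2 * m + length W′) ∎
        where
        open ≤-Reasoning
        split : ∀ v → v ∈ xs → Good v ⊎ (¬ Outside v ⊎ v ∈ W′)
        split v v∈ with outside? v | v ∈? W′
        ... | no ¬o | _ = inj₂ (inj₁ ¬o)
        ... | yes o | yes w = inj₂ (inj₂ w)
        ... | yes o | no ¬w = inj₁ (v∈ , o , ¬w)

      restrict : ∀ {i} → Dec (i ∈ P) → Maybe (Fin V) → Maybe (Fin V)
      restrict (yes _) _ = nothing
      restrict (no _) x = x

      restrict-sound : ∀ {i} (d : Dec (i ∈ P)) {x v} → restrict d x ≡ just v → x ≡ just v × i ∉ P
      restrict-sound (no ¬p) e = e , ¬p

      restrict-weight : ∀ {i} (d : Dec (i ∈ P)) x y → ⟦ x ⟧ + ⟦ y ⟧ ≤ (⟦ restrict d x ⟧ + ⟦ restrict d y ⟧) + 2 * χ d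
      restrict-weight (no _) x y = m≤m+n _ _
      restrict-weight (yes _) (just _) (just _) = ≤-refl
      restrict-weight (yes _) (just _) nothing = s≤s z≤n
      restrict-weight (yes _) nothing (just _) = s≤s z≤n
      restrict-weight (yes _) nothing nothing = z≤n

    -- A vertex of `xs` is covered by `μ₀`, forbidden by `W′`, or good. Good vertices label distinct
    -- slots by `slot-unique`, and a label determines its slot, which gives injectivity. Edges in
    -- `P` may no longer be those of `μ₀`; dropping their slots costs at most two labels each.
    row : ∃ λ τ → IsRow γ P W′ τ × length xs ≤ sum (weight τ) + (2 * length P + (2 * m + length W′))
    row = τ , record { sound = sound ; injective = injective } , size
      where
      τ : Row m V
      τ i b = restrict (i ∈? P) (τ′ i b)
      sound : ∀ i b {v} → τ i b ≡ just v → Outside v × v ∉ W′ × i ∉ P × Adj G γ (end i b) v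
      sound i b e with restrict-sound (i ∈? P) e
      ... | e′ , i∉ with label-sound (any? (at? (i , b))) e′
      ...   | (_ , o , v∉) , st = o , v∉ , i∉ , subst (λ u → Adj G γ u _) (moved b) (slotOf-sound (slot? _) st)
        where
        moved : ∀ b → endOf μ i b ≡ end i b
        moved true = cong end₁ (same i i∉)
        moved false = cong end₂ (same i i∉)
      injective : ∀ {i b j b′ v} → τ i b ≡ just v → τ j b′ ≡ just v → (i , b) ≡ (j , b′)
      injective {i} {b} {j} {b′} e e′ = Data.Maybe.Properties.just-injective (trans
        (sym (proj₂ (label-sound (any? (at? (i , b))) (proj₁ (restrict-sound (i ∈? P) e)))))
        (proj₂ (label-sound (any? (at? (j , b′))) (proj₁ (restrict-sound (j ∈? P) e′)))))
      size : length xs ≤ sum (weight τ) + (2 * length P + (2 * m + length W′))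
      size = begin
        length xs ≤⟨ xs≤good ⟩
        ♯ good? + (2 * m + length W′) ≤⟨ +-monoˡ-≤ _ ♯-good ⟩
        sum (weight τ′) + (2 * m + length W′) ≤⟨ +-monoˡ-≤ _ (sum-mono λ i → restrict-weight (i ∈? P) (τ′ i true) (τ′ i false)) ⟩
        sum (λ i → weight τ i + 2 * χ (i ∈? P)) + (2 * m + length W′) ≡⟨ cong (_+ _) (trans (∑-distrib-+ (weight τ) (λ i → 2 * χ (i ∈? P))) (cong (sum (weight τ) +_) (sym (*-distribˡ-sum 2 (λ i → χ (i ∈? P)))))) ⟩
        sum (weight τ) + 2 * ♯ (_∈? P) + (2 * m + length W′) ≤⟨ +-monoˡ-≤ _ (+-monoʳ-≤ (sum (weight τ)) (*-monoʳ-≤ 2 (♯-∈≤length P))) ⟩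
        sum (weight τ) + 2 * length P + (2 * m + length W′) ≡⟨ +-assoc (sum (weight τ)) _ _ ⟩
        sum (weight τ) + (2 * length P + (2 * m + length W′)) ∎
        where open ≤-Reasoning

-- Weights of rows and numerical bounds

none : ∀ {m v} → Row m v
none _ _ = nothing

⟦⟧≤1 : {A : Set} (x : Maybe A) → ⟦ x ⟧ ≤ 1
⟦⟧≤1 (just _) = ≤-refl
⟦⟧≤1 nothing = z≤n

weight≤2 : ∀ {m v} (τ : Row m v) i → weight τ i ≤ 2
weight≤2 τ i = +-mono-≤ (⟦⟧≤1 (τ i true)) (⟦⟧≤1 (τ i false))

module _ {m v} (τ : Row m v) where

  touched? : Decidable (λ i → 1 ≤ weight τ i)
  touched? i = 1 ≤? weight τ i

  weight≤2χ : ∀ i (t : Dec (1 ≤ weight τ i)) → weight τ i ≤ 2 * χ t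
  weight≤2χ i (yes _) = weight≤2 τ i
  weight≤2χ i (no ¬t) = ≤-reflexive (n<1⇒n≡0 (≰⇒> ¬t))

  firstLabel : Fin m → Maybe (Fin v)
  firstLabel i = τ i true <∣> τ i false

  firstLabel-slot : ∀ i {x} → firstLabel i ≡ just x → ∃ λ b → τ i b ≡ just x
  firstLabel-slot i e with τ i true in eq
  ... | just _ = true , trans eq e
  ... | nothing = false , e

  touched-label : ∀ i → 1 ≤ weight τ i → ∃ λ x → firstLabel i ≡ just x
  touched-label i h with τ i true | τ i false
  ... | just x | _ = x , refl
  ... | nothing | just x = x , refl

  full-label : ∀ i → weight τ i ≡ 2 → ∀ b → ∃ λ x → τ i b ≡ just x
  full-label i h = λ { true → proj₁ (both _ _ h) ; false → proj₂ (both _ _ h) }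
    where
    both : (x y : Maybe (Fin v)) → ⟦ x ⟧ + ⟦ y ⟧ ≡ 2 → (∃ λ z → x ≡ just z) × (∃ λ z → y ≡ just z)
    both (just _) (just _) _ = (_ , refl) , (_ , refl)
    both (just _) nothing ()
    both nothing (just _) ()
    both nothing nothing ()

-- For `e` at most 6 the upper bound on `m` is at most `8 * e`, below the lower bound `12 * e + 3`.
7≤e : ∀ {m e} → m ≤ e * e + 2 * e → 12 * e + 3 ≤ m → 7 ≤ e
7≤e {m} {e} small big = ≮⇒≥ λ { (s≤s e≤6) → <⇒≱ (m<m+n (12 * e) {3} (s≤s z≤n)) (begin
  12 * e + 3 ≤⟨ big ⟩
  m ≤⟨ small ⟩
  e * e + 2 * e ≤⟨ +-monoˡ-≤ (2 * e) (*-monoˡ-≤ e e≤6) ⟩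
  6 * e + 2 * e ≤⟨ ≤-trans (≤-reflexive (sym (*-distribʳ-+ e 6 2))) (*-monoˡ-≤ e (m≤m+n 8 4)) ⟩
  12 * e ∎) }
  where open ≤-Reasoning

-- The hypotheses give N(6e - 10) ≤ 4m ≤ 4e² + 8e. For N ≥ e + 1 and e = 7 + k the left side would
-- exceed the right one by at least 4 + 16k + 2k².
heavy-few : ∀ {m e N T} → 7 ≤ e → m ≤ e * e + 2 * e → N * (6 * e) ≤ N * 10 + 2 * T → T ≤ 2 * m → N ≤ e
heavy-few {m} {e} {N} {T} 7≤e small h t≤ with m≤n⇒∃[o]m+o≡n 7≤e
... | k , refl = ≮⇒≥ λ lt → <⇒≱ (impossible k) (≤-cancel (N * 10) refl (rhs k N) (≤-trans
      (+-mono-≤ (*-monoˡ-≤ (32 + 6 * k) lt) ≤-refl)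
      (≤-trans (≤-reflexive (mid k N)) (≤-trans h (+-monoʳ-≤ (N * 10) (*-monoʳ-≤ 2 (≤-trans t≤ (*-monoʳ-≤ 2 small))))))))
  where
  rhs : ∀ k N → N * 10 + 2 * (2 * ((7 + k) * (7 + k) + 2 * (7 + k))) ≡ 2 * (2 * ((7 + k) * (7 + k) + 2 * (7 + k))) + N * 10
  rhs = solve-∀
  mid : ∀ k N → N * (32 + 6 * k) + N * 10 ≡ N * (6 * (7 + k))
  mid = solve-∀
  impossible : ∀ k → 2 * (2 * ((7 + k) * (7 + k) + 2 * (7 + k))) < (8 + k) * (32 + 6 * k)
  impossible k = ≤-trans (m≤m+n _ (3 + 16 * k + 2 * (k * k))) (≤-reflexive (id′ k))
    where
    id′ : ∀ k → suc (2 * (2 * ((7 + k) * (7 + k) + 2 * (7 + k)))) + (3 + 16 * k + 2 * (k * k)) ≡ (8 + k) * (32 + 6 * k)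
    id′ = solve-∀

-- The sets S₁ and S₂

module Main {n : ℕ} (G : ColouredMultigraph n) {m : ℕ} (μ₀ : Fin m → Fin (ColouredMultigraph.E G))
  (M₀ : Graph.IsMatching G μ₀) (maximal : ¬ ∃ (Graph.IsMatching G {suc m}))
  (c₀ : Fin n) (c₀-missing : Graph.Missing G μ₀ c₀) (e : ℕ) (m≤ : m ≤ e * e + 2 * e)
  (cliques : ∀ γ → DisjointUnionOfNontrivialCliques G γ)
  (vertices : ∀ γ → ∃ λ xs → Unique xs × All (InColour G γ) xs × 3 * m + (12 * e + 3) ≤ length xs)
  where

  open ColouredMultigraph G
  open Graph G
  open Switching G μ₀ M₀ maximal

  κ : Fin m → Fin n
  κ i = colour (μ₀ i)

  abstract
    -- The `2 * m` vertices covered by `μ₀` are cancelled here. What remains is an average of more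
    -- than one label per matching edge, up to the cost of the path.
    rowFor : ∀ {P W γ} → State P W γ → ∀ W′ → W ⊆ W′ →
      ∃ λ τ → IsRow γ P W′ τ × m + (12 * e + 3) ≤ sum (weight τ) + (2 * length P + length W′)
    rowFor {P} {W} {γ} s W′ W⊆ with vertices γ
    ... | xs , u , inγ , big with row s W′ W⊆ (cliques γ) xs u inγ
    ...   | τ , isRow , size = τ , isRow , ≤-cancel (2 * m) (lhs m e) (rhs m (sum (weight τ)) (length P) (length W′)) (≤-trans big size)
      where
      lhs : ∀ m e → 3 * m + (12 * e + 3) ≡ m + (12 * e + 3) + 2 * m
      lhs = solve-∀
      rhs : ∀ m s p w → s + (2 * p + (2 * m + w)) ≡ s + (2 * p + w) + 2 * m
      rhs = solve-∀

  module _ {γ P W τ} (r : IsRow γ P W τ) where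
    open IsRow r

    firstLabel-injective : ∀ {i j x} → firstLabel τ i ≡ just x → firstLabel τ j ≡ just x → i ≡ j
    firstLabel-injective {i} {j} p q with firstLabel-slot τ i p | firstLabel-slot τ j q
    ... | _ , p′ | _ , q′ = ,-injectiveˡ (injective p′ q′)

    slot∉ : ∀ {i b x} → τ i b ≡ just x → i ∉ P
    slot∉ p = proj₁ (proj₂ (proj₂ (sound _ _ p)))

    touched-firstLabel-unique : ∀ i j → 1 ≤ weight τ i → ∀ {x} → firstLabel τ i ≡ x → firstLabel τ j ≡ x → i ≡ j
    touched-firstLabel-unique i j t p q with touched-label τ i t
    ... | y , l = firstLabel-injective l (trans q (trans (sym p) l))

  row₀ : ∃ λ τ → IsRow c₀ [] [] τ × m + (12 * e + 3) ≤ sum (weight τ) + 0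
  row₀ = rowFor (start c₀-missing) [] id

  τ₀ : Row m V
  τ₀ = proj₁ row₀

  isRow₀ : IsRow c₀ [] [] τ₀
  isRow₀ = proj₁ (proj₂ row₀)

  S₁ : Pred (Fin m) 0ℓ
  S₁ c = 1 ≤ weight τ₀ c

  S₁? : Decidable S₁
  S₁? = touched? τ₀

  ℓ : Fin m → Maybe (Fin V)
  ℓ = firstLabel τ₀

  S₁-many : m + (12 * e + 3) ≤ 2 * ♯ S₁?
  S₁-many = begin
    m + (12 * e + 3) ≤⟨ proj₂ (proj₂ row₀) ⟩
    sum (weight τ₀) + 0 ≡⟨ +-identityʳ _ ⟩
    sum (weight τ₀) ≤⟨ sum-mono (λ i → weight≤2χ τ₀ i (S₁? i)) ⟩
    sum (λ i → 2 * χ (S₁? i)) ≡⟨ sym (*-distribˡ-sum 2 (χ ∘ S₁?)) ⟩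
    2 * ♯ S₁? ∎
    where open ≤-Reasoning

  -- Since `S₁` has at most `m` elements, `S₁-many` forces `12 * e + 3 ≤ m`.
  e≥7 : 7 ≤ e
  e≥7 = 7≤e m≤ (+-cancelˡ-≤ m _ _ (≤-trans S₁-many (≤-trans (*-monoʳ-≤ 2 (♯≤ S₁?)) (≤-reflexive (cong (m +_) (+-identityʳ m))))))

  record Row₁ (f : Fin m) (τ : Row m V) : Set where
    field
      {x}   : Fin V
      label : ℓ f ≡ just x
      state : State (f ∷ []) (x ∷ []) (κ f)
      isRow : IsRow (κ f) (f ∷ []) (x ∷ []) τ
      -- The 3 pays for the two ends of edge `f` and the spent vertex `x`.
      size  : m + (12 * e + 3) ≤ sum (weight τ) + 3

  abstract
    someRow₁ : ∀ f → S₁ f → ∃ (Row₁ f)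
    someRow₁ f s =
      let (x , label) = touched-label τ₀ f s
          (b , slot) = firstLabel-slot τ₀ f label
          (out , _ , _ , adj) = IsRow.sound isRow₀ f b slot
          (state , _) = advance (start c₀-missing) f b (λ ()) adj out (λ ())
          (τ , isRow , size) = rowFor state (x ∷ []) id
      in τ , record { label = label ; state = state ; isRow = isRow ; size = size }

    τ₁ : Fin m → Row m V
    τ₁ f with S₁? f
    ... | yes s = proj₁ (someRow₁ f s)
    ... | no _ = none

    row₁ : ∀ f → S₁ f → Row₁ f (τ₁ f)
    row₁ f s with S₁? f
    ... | yes s′ = proj₂ (someRow₁ f s′)
    ... | no ¬s = contradiction s ¬s

  -- The middle edges `f` of the paths c₀ → f → c. Such a path spends the outside vertices `ℓ f` and
  -- `via c f`.
  Fan : Fin m → Pred (Fin m) 0ℓ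
  Fan c f = S₁ f × 1 ≤ weight (τ₁ f) c

  fan? : ∀ c → Decidable (Fan c)
  fan? c f = S₁? f ×-dec touched? (τ₁ f) c

  via : Fin m → Fin m → Maybe (Fin V)
  via c f = firstLabel (τ₁ f) c

  via-unique : ∀ {f c c′ x} → Fan c f → via c f ≡ x → via c′ f ≡ x → c ≡ c′
  via-unique {f} {c} {c′} (s , t) p q = touched-firstLabel-unique (Row₁.isRow (row₁ f s)) c c′ t p q

  ℓ-unique : ∀ {f f′ x} → S₁ f → ℓ f ≡ x → ℓ f′ ≡ x → f ≡ f′
  ℓ-unique s = touched-firstLabel-unique isRow₀ _ _ s

  S₂ : Pred (Fin m) 0ℓ
  S₂ c = ¬ S₁ c × 6 * e ≤ ♯ (fan? c)

  S₂? : Decidable S₂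
  S₂? c = ¬? (S₁? c) ×-dec 6 * e ≤? ♯ (fan? c)

  S : Pred (Fin m) 0ℓ
  S c = S₁ c ⊎ S₂ c

  S? : Decidable S
  S? c = S₁? c ⊎-dec S₂? c

  viaClass? : ∀ c x → Decidable (λ f → Fan c f × via c f ≡ x)
  viaClass? c x f = fan? c f ×-dec via c f ≟ₘ x

  -- A vertex that could block most of the paths to `c`. The row built in `srow₂` must not use it as
  -- a label.
  Heavy : Fin m → Fin V → Set
  Heavy c x = ♯ (fan? c) < 2 * ♯ (viaClass? c (just x))

  -- Each `f` has a single `via c f`, so two heavy vertices would own disjoint parts of the fan,
  -- each more than half of it.
  heavy-unique : ∀ {c x y} → Heavy c x → Heavy c y → x ≡ y
  heavy-unique {c} {x} {y} hx hy with x Fin.≟ y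
  ... | yes p = p
  ... | no x≢y = contradiction (+-mono-< hx hy) (≤⇒≯ (≤-trans
        (≤-reflexive (sym (*-distribˡ-+ 2 (♯ (viaClass? c (just x))) _)))
        (≤-trans (*-monoʳ-≤ 2 (♯-disjoint (viaClass? c (just x)) (viaClass? c (just y)) (fan? c)
          (λ _ → proj₁) (λ _ → proj₁) λ f p q → x≢y (Data.Maybe.Properties.just-injective (trans (sym (proj₂ p)) (proj₂ q)))))
          (≤-reflexive (cong (♯ (fan? c) +_) (+-identityʳ _))))))

  -- By avoid, a label on an edge leaving c never obstructs all paths from c₀ to c.
  record IsSRow (c : Fin m) (τ : Row m V) : Set where
    field
      {P}   : List (Fin m)
      {W}   : List (Fin V)
      isRow : IsRow (κ c) P W τ
      self  : c ∈ P
      size  : m + (6 * e + 19) ≤ sum (weight τ)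
      avoid : ∀ {x} → x ∉ W → (S₁ c × ℓ c ≢ just x) ⊎ (S₂ c × ¬ Heavy c x)

  -- The loss `k` is 3 for rows of `S₁` and 2 · 2 + 3 = 7 for rows of `S₂`; half of the surplus
  -- `12 * e` covers it because `6 * e + 3 ≥ 26`. The target `6 * e + 19` is one more than the bound
  -- 2 · 3(e + 3) used in `Bad-few`.
  large : ∀ {s k} → k ≤ 7 → m + (12 * e + 3) ≤ s + k → m + (6 * e + 19) ≤ s
  large {s} {k} k≤7 h = ≤-cancel 7 refl refl (≤-trans (≤-trans (≤-reflexive (assoc′ m e))
    (+-monoʳ-≤ m (≤-trans (+-monoʳ-≤ (6 * e) (≤-trans (m≤m+n 26 (16 + 3)) (+-monoˡ-≤ 3 (*-monoʳ-≤ 6 e≥7)))) (≤-reflexive (double e)))))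
    (≤-trans h (+-monoʳ-≤ s k≤7)))
    where
    assoc′ : ∀ m e → m + (6 * e + 19) + 7 ≡ m + (6 * e + 26)
    assoc′ = solve-∀
    double : ∀ e → 6 * e + (6 * e + 3) ≡ 12 * e + 3
    double = solve-∀

  srow₁ : ∀ f → S₁ f → IsSRow f (τ₁ f)
  srow₁ f s = record
    { isRow = Row₁.isRow r ; self = here refl ; size = large (m≤m+n 3 4) (Row₁.size r)
    ; avoid = λ x∉ → inj₁ (s , λ p → x∉ (here (Data.Maybe.Properties.just-injective (trans (sym p) (Row₁.label r))))) }
    where
    r : Row₁ f (τ₁ f)
    r = row₁ f s

  record Path₂ (c f : Fin m) : Set where
    field
      {x y} : Fin V
      ℓ≡    : ℓ f ≡ just x
      via≡  : via c f ≡ just y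
      state : State (c ∷ f ∷ []) (y ∷ x ∷ []) (κ c)

  abstract
    path₂ : ∀ {c f} → Fan c f → Path₂ c f
    path₂ {c} {f} (s , t) =
      let (y , via≡) = touched-label (τ₁ f) c t
          (b , slot) = firstLabel-slot (τ₁ f) c via≡
          (out , y∉ , c∉ , adj) = IsRow.sound (Row₁.isRow (row₁ f s)) c b slot
          (state , _) = advance (Row₁.state (row₁ f s)) c b c∉ adj out y∉
      in record { ℓ≡ = Row₁.label (row₁ f s) ; via≡ = via≡ ; state = state }

  heavy? : ∀ c → Decidable (Heavy c)
  heavy? c x = ♯ (fan? c) ℕ.<? 2 * ♯ (viaClass? c (just x))

  heaviest : ∀ c → Fin V → ∃ λ y → ∀ {x} → Heavy c x → x ≡ y
  heaviest c default with any? (heavy? c)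
  ... | yes (y , hy) = y , λ hx → heavy-unique hx hy
  -- `srow₂` passes as `default` a vertex that is forbidden already.
  ... | no ¬h = default , λ hx → contradiction (_ , hx) ¬h

  abstract
    srow₂ : ∀ c → S₂ c → ∃ (IsSRow c)
    srow₂ c s₂@(_ , big) =
      let (f , fan) = ♯-∃ (fan? c) (≤-trans (≤-trans (s≤s z≤n) (*-monoʳ-≤ 6 e≥7)) big)
          p = path₂ fan
          (y , heavy) = heaviest c (Path₂.x p)
          -- Forbidding the heaviest vertex besides the two spent ones ensures that no label of this
          -- row blocks more than half of the fan of `c`.
          (τ , isRow , size) = rowFor (Path₂.state p) (Path₂.y p ∷ Path₂.x p ∷ y ∷ [])
            λ { (here q) → here q ; (there (here q)) → there (here q) }
      in τ , record
        { isRow = isRow ; self = here refl ; size = large ≤-refl size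
        ; avoid = λ x∉ → inj₂ (s₂ , λ h → x∉ (there (there (here (heavy h))))) }

  ρ′ : ∀ c → Dec (S₁ c) → Dec (S₂ c) → Row m V
  ρ′ c (yes _) _ = τ₁ c
  ρ′ c (no _) (yes s) = proj₁ (srow₂ c s)
  ρ′ c (no _) (no _) = none

  abstract
    ρ : Fin m → Row m V
    ρ c = ρ′ c (S₁? c) (S₂? c)

    srow : ∀ c → S c → IsSRow c (ρ c)
    srow c = aux (S₁? c) (S₂? c)
      where
      aux : ∀ d₁ d₂ → S c → IsSRow c (ρ′ c d₁ d₂)
      aux (yes s) _ _ = srow₁ c s
      aux (no _) (yes s) _ = proj₂ (srow₂ c s)
      aux (no ¬s) (no _) (inj₁ s) = contradiction s ¬s
      aux (no _) (no ¬s) (inj₂ s) = contradiction s ¬s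

    ρ-out : ∀ c d → ¬ S c → weight (ρ c) d ≡ 0
    ρ-out c d ¬s = aux (S₁? c) (S₂? c)
      where
      aux : ∀ d₁ d₂ → weight (ρ′ c d₁ d₂) d ≡ 0
      aux (yes s) _ = contradiction (inj₁ s) ¬s
      aux (no _) (yes s) = contradiction (inj₂ s) ¬s
      aux (no _) (no _) = refl

    -- For `c` in `S₁`, a positive weight at `d` puts `c` into the fan of `d`. This bounds column
    -- sums by fan sizes, which are small outside `S`.
    ρ-weight : ∀ c d → weight (ρ c) d ≤ 2 * χ (fan? d c) + 2 * χ (S₂? c)
    ρ-weight c d = aux (S₁? c) (S₂? c)
      where
      aux : ∀ d₁ d₂ → weight (ρ′ c d₁ d₂) d ≤ 2 * χ (fan? d c) + 2 * χ d₂
      aux (yes s) _ = ≤-trans (≤-trans (weight≤2χ (τ₁ c) d (touched? (τ₁ c) d))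
        (*-monoʳ-≤ 2 (χ-mono (touched? (τ₁ c) d) (fan? d c) (s ,_)))) (m≤m+n _ _)
      aux (no _) (yes s) = ≤-trans (weight≤2 (proj₁ (srow₂ c s)) d) (m≤n+m _ _)
      aux (no _) (no _) = z≤n

  w : Fin m → Fin m → ℕ
  w c d = weight (ρ c) d

  S₁+S₂≤S : ♯ S₁? + ♯ S₂? ≤ ♯ S?
  S₁+S₂≤S = ♯-disjoint S₁? S₂? S? (λ _ → inj₁) (λ _ → inj₂) λ _ s ¬s → proj₁ ¬s s

  -- The fan of `d` has fewer than 6e elements, so the column sum is below 12e + 2|S₂|. Since 2|S₁|
  -- ≥ m + 12e + 3 while |S₁| + |S₂| is at most both |S| and m, this is at most |S|.
  columns : ∀ d → ¬ S d → sum (λ c → w c d) ≤ ♯ S?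
  columns d ¬s = begin
    sum (λ c → w c d) ≤⟨ sum-mono (λ c → ρ-weight c d) ⟩
    sum (λ c → 2 * χ (fan? d c) + 2 * χ (S₂? c))
      ≡⟨ trans (∑-distrib-+ (λ c → 2 * χ (fan? d c)) (λ c → 2 * χ (S₂? c)))
           (cong₂ _+_ (sym (*-distribˡ-sum 2 (χ ∘ fan? d))) (sym (*-distribˡ-sum 2 (χ ∘ S₂?)))) ⟩
    2 * ♯ (fan? d) + 2 * ♯ S₂? ≤⟨ m≤m+n _ 3 ⟩
    2 * ♯ (fan? d) + 2 * ♯ S₂? + 3 ≤⟨ ≤-cancel (2 * ♯ S₁? + m) (lhs (♯ (fan? d)) (♯ S₁?) (♯ S₂?) m) (rhs (♯ S₁?) (♯ S?) m)
        (+-mono-≤ (+-mono-≤ S₁+S₂≤S (≤-trans S₁+S₂≤S (♯≤ S?)))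
          (≤-trans (+-monoʳ-≤ m (+-monoˡ-≤ 3 few)) S₁-many)) ⟩
    ♯ S? ∎
    where
    open ≤-Reasoning
    few : 2 * ♯ (fan? d) ≤ 12 * e
    few = ≤-trans (*-monoʳ-≤ 2 (<⇒≤ (≰⇒> λ h → ¬s (inj₂ ((λ s₁ → ¬s (inj₁ s₁)) , h))))) (≤-reflexive (sym (*-assoc 2 6 e)))
    lhs : ∀ F a b m → (a + b + (a + b)) + (m + (2 * F + 3)) ≡ 2 * F + 2 * b + 3 + (2 * a + m)
    lhs = solve-∀
    rhs : ∀ a q m → (q + m) + 2 * a ≡ q + (2 * a + m)
    rhs = solve-∀

  open Surplus S? w (6 * e + 19) (λ c d → weight≤2 (ρ c) d) ρ-out (λ c s → IsSRow.size (srow c s)) columns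

  -- Blocked paths and colliding labels

  crowded? : ∀ x y → Decidable (λ c → 6 * e ≤ 10 + 2 * ♯ (λ f → fan? c f ×-dec (via c f ≟ₘ x ⊎-dec via c f ≟ₘ y)))
  crowded? x y c = _ ≤? _

  -- Double counting: labels in a row are injective, so each `f` reaches at most one `c` through `x`
  -- and one through `y`. The counts over all `c` thus add up to at most `2 * m`, whereas each
  -- crowded `c` takes at least 3e - 5.
  crowded-few : ∀ x y → ♯ (crowded? x y) ≤ e
  crowded-few x y = heavy-few e≥7 m≤ per-c per-f
    where
    open ≤-Reasoning
    count : Fin m → ℕ
    count c = ♯ (λ f → fan? c f ×-dec (via c f ≟ₘ x ⊎-dec via c f ≟ₘ y))
    one : ∀ c (k : Dec (6 * e ≤ 10 + 2 * count c)) → χ k * (6 * e) ≤ χ k * 10 + 2 * count c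
    one c (yes h) = ≤-trans (≤-reflexive (+-identityʳ _)) h
    one c (no _) = z≤n
    per-c : ♯ (crowded? x y) * (6 * e) ≤ ♯ (crowded? x y) * 10 + 2 * sum count
    per-c = begin
      ♯ (crowded? x y) * (6 * e) ≡⟨ *-distribʳ-sum (6 * e) (χ ∘ crowded? x y) ⟩
      sum (λ c → χ (crowded? x y c) * (6 * e)) ≤⟨ sum-mono (λ c → one c (crowded? x y c)) ⟩
      sum (λ c → χ (crowded? x y c) * 10 + 2 * count c) ≡⟨ ∑-distrib-+ (λ c → χ (crowded? x y c) * 10) (λ c → 2 * count c) ⟩
      sum (λ c → χ (crowded? x y c) * 10) + sum (λ c → 2 * count c)
        ≡⟨ cong₂ _+_ (sym (*-distribʳ-sum 10 (χ ∘ crowded? x y))) (sym (*-distribˡ-sum 2 count)) ⟩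
      ♯ (crowded? x y) * 10 + 2 * sum count ∎
    fibre : ∀ f → ♯ (λ c → fan? c f ×-dec (via c f ≟ₘ x ⊎-dec via c f ≟ₘ y)) ≤ 2
    fibre f = ≤-trans (♯-⊎ (λ c → fan? c f ×-dec (via c f ≟ₘ x ⊎-dec via c f ≟ₘ y)) (λ c → viaClass? c x f) (λ c → viaClass? c y f)
      λ { _ (p , inj₁ q) → inj₁ (p , q) ; _ (p , inj₂ q) → inj₂ (p , q) })
      (+-mono-≤ (♯-unique (λ c → viaClass? c x f) λ _ _ (p , q) (_ , q′) → via-unique p q q′)
                (♯-unique (λ c → viaClass? c y f) λ _ _ (p , q) (_ , q′) → via-unique p q q′))
    per-f : sum count ≤ 2 * m
    per-f = begin
      sum count ≡⟨ ∑-comm (λ c f → χ (fan? c f ×-dec (via c f ≟ₘ x ⊎-dec via c f ≟ₘ y))) ⟩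
      sum (λ f → ♯ (λ c → fan? c f ×-dec (via c f ≟ₘ x ⊎-dec via c f ≟ₘ y))) ≤⟨ sum-mono fibre ⟩
      sum (λ (_ : Fin m) → 2) ≡⟨ trans (sum-const m 2) (*-comm m 2) ⟩
      2 * m ∎

  module Collision (d : Fin m) (sd : S d) (b : Bool) where

    -- The end of the augmenting path c₁ → d → c₂ spends `enter c₁` at end `b` of `d`, then
    -- `hop c₂`, and finally `close c₂` at the freed end of `d`.
    enter close hop : Fin m → Maybe (Fin V)
    enter c = ρ c d b
    close c = ρ c d (not b)
    hop c = firstLabel (ρ d) c

    -- The inequality excludes the one coincidence that concerns `c₂` alone. `Bad-few` covers all
    -- bad indices by using both values of `b`.
    Q : Pred (Fin m) 0ℓ
    Q c = Bad d c × close c ≢ hop c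

    Q? : Decidable Q
    Q? c = Bad? d c ×-dec ¬? (close c ≟ₘ hop c)

    not≢ : ∀ b → b ≢ not b
    not≢ true ()
    not≢ false ()

    label : ∀ {c} → Bad d c → ∀ b′ → ∃ λ x → ρ c d b′ ≡ just x
    label {c} (_ , _ , two , _) = full-label (ρ c) d two

    hop-label : ∀ {c} → Bad d c → ∃ λ y → hop c ≡ just y
    hop-label {c} (_ , _ , _ , t) = touched-label (ρ d) c t

    row-of : ∀ {c} → Bad d c → IsSRow c (ρ c)
    row-of {c} (_ , s , _) = srow c s

    enter≢close : ∀ c → Bad d c → enter c ≢ close c
    enter≢close c bad eq =
      let (x , e) = label bad b in
      not≢ b (cong proj₂ (IsRow.injective (IsSRow.isRow (row-of bad)) e (trans (sym eq) e)))

    hop-injective : ∀ c c′ → Q c → Q c′ → hop c ≡ hop c′ → c ≡ c′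
    hop-injective c c′ ((_ , _ , _ , t) , _) _ eq = touched-firstLabel-unique (IsSRow.isRow (srow d sd)) c c′ t eq refl

    -- f can serve as the intermediate step of a path from c₀ to c₁.
    Usable : Fin m → Fin m → Pred (Fin m) 0ℓ
    Usable c₂ c₁ f = Fan c₁ f × (f ≢ c₂ × f ≢ d) × (ℓ f ≢ enter c₁ × ℓ f ≢ close c₂ × ℓ f ≢ hop c₂)
      × (via c₁ f ≢ enter c₁ × via c₁ f ≢ close c₂ × via c₁ f ≢ hop c₂)

    usable? : ∀ c₂ c₁ → Decidable (Usable c₂ c₁)
    usable? c₂ c₁ f = fan? c₁ f ×-dec (¬? (f Fin.≟ c₂) ×-dec ¬? (f Fin.≟ d))
      ×-dec (¬? (ℓ f ≟ₘ enter c₁) ×-dec ¬? (ℓ f ≟ₘ close c₂) ×-dec ¬? (ℓ f ≟ₘ hop c₂))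
      ×-dec (¬? (via c₁ f ≟ₘ enter c₁) ×-dec ¬? (via c₁ f ≟ₘ close c₂) ×-dec ¬? (via c₁ f ≟ₘ hop c₂))

    -- The two kinds of path to `c₁`: c₀ → c₁ and c₀ → f → c₁. For the first kind, `ℓ c₁ ≢ enter c₁`
    -- is supplied by `avoid`.
    Ok : Fin m → Pred (Fin m) 0ℓ
    Ok c₂ c₁ = (S₁ c₁ × ℓ c₁ ≢ close c₂ × ℓ c₁ ≢ hop c₂) ⊎ ∃ (Usable c₂ c₁)

    ok? : ∀ c₂ → Decidable (Ok c₂)
    ok? c₂ c₁ = (S₁? c₁ ×-dec ¬? (ℓ c₁ ≟ₘ close c₂) ×-dec ¬? (ℓ c₁ ≟ₘ hop c₂)) ⊎-dec any? (usable? c₂ c₁)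

    module _ {c₁ c₂} (q₁ : Q c₁) (q₂ : Q c₂) (c₁≢c₂ : c₁ ≢ c₂)
      (e≢c : enter c₁ ≢ close c₂) (e≢h : enter c₁ ≢ hop c₂) where

      c₂≢d : c₂ ≢ d
      c₂≢d refl = slot∉ (IsSRow.isRow (row-of (proj₁ q₂))) (proj₂ (label (proj₁ q₂) b)) (IsSRow.self (row-of (proj₁ q₂)))

      d≢c₁ : d ≢ c₁
      d≢c₁ refl = slot∉ (IsSRow.isRow (row-of (proj₁ q₁))) (proj₂ (label (proj₁ q₁) b)) (IsSRow.self (row-of (proj₁ q₁)))

      -- The three vertices spent at the end of the path are distinct from each other by `Q c₂`,
      -- `e≢c` and `e≢h`, and distinct from the earlier ones by the last hypothesis, so `win`
      -- applies.
      finish : ∀ {P W} → State P W (κ c₁) → d ∉ P → c₂ ∉ P →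
        (∀ {v} → v ∈ W → just v ≢ enter c₁ × just v ≢ close c₂ × just v ≢ hop c₂) → ⊥
      finish {P} {W} s d∉ c₂∉ away =
        let (x , ex) = label (proj₁ q₁) b
            (z , ez) = label (proj₁ q₂) (not b)
            (y , ey) = hop-label (proj₁ q₂)
            (b′ , ey′) = firstLabel-slot (ρ d) c₂ ey
            (ox , _ , _ , ax) = IsRow.sound (IsSRow.isRow (row-of (proj₁ q₁))) d b ex
            (oz , _ , _ , az) = IsRow.sound (IsSRow.isRow (row-of (proj₁ q₂))) d (not b) ez
            (oy , _ , _ , ay) = IsRow.sound (IsSRow.isRow (srow d sd)) c₂ b′ ey′
        in win {b = b} {b′} s d∉ (λ { (here p) → c₂≢d p ; (there p) → c₂∉ p })
          ax ox (λ p → proj₁ (away p) (sym ex))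
          ay oy (λ { (here p) → e≢h (trans ex (trans (cong just (sym p)) (sym ey))) ; (there p) → proj₂ (proj₂ (away p)) (sym ey) })
          az oz (λ { (here p) → proj₂ q₂ (trans ez (trans (cong just p) (sym ey))) ; (there (here p)) → e≢c (trans ex (trans (cong just (sym p)) (sym ez)))
                   ; (there (there p)) → proj₁ (proj₂ (away p)) (sym ez) })

      no-path : ¬ Ok c₂ c₁
      no-path (inj₁ (s₁ , ℓ≢c , ℓ≢h)) =
        let r = row₁ c₁ s₁
            (x , ex) = label (proj₁ q₁) b
            (_ , x∉ , _) = IsRow.sound (IsSRow.isRow (row-of (proj₁ q₁))) d b ex
        in finish (Row₁.state r) (λ { (here p) → d≢c₁ p }) (λ { (here p) → c₁≢c₂ (sym p) })
          λ { (here refl) → (λ p → avoid ex x∉ (trans (Row₁.label r) p)) , (λ p → ℓ≢c (trans (Row₁.label r) p)) , (λ p → ℓ≢h (trans (Row₁.label r) p)) }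
        where
        avoid : ∀ {x} → enter c₁ ≡ just x → x ∉ IsSRow.W (row-of (proj₁ q₁)) → ℓ c₁ ≢ enter c₁
        avoid ex x∉ p with IsSRow.avoid (row-of (proj₁ q₁)) x∉
        ... | inj₁ (_ , ℓ≢) = ℓ≢ (trans p ex)
        ... | inj₂ ((¬s₁ , _) , _) = ¬s₁ s₁
      no-path (inj₂ (f , fan , (f≢c₂ , f≢d) , (ℓ≢e , ℓ≢c , ℓ≢h) , (v≢e , v≢c , v≢h))) =
        let p = path₂ fan in
        finish (Path₂.state p) (λ { (here q) → d≢c₁ q ; (there (here q)) → f≢d (sym q) })
          (λ { (here q) → c₁≢c₂ (sym q) ; (there (here q)) → f≢c₂ (sym q) })
          λ { (here refl) → v≢e ∘ trans (Path₂.via≡ p) , v≢c ∘ trans (Path₂.via≡ p) , v≢h ∘ trans (Path₂.via≡ p)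
            ; (there (here refl)) → ℓ≢e ∘ trans (Path₂.ℓ≡ p) , ℓ≢c ∘ trans (Path₂.ℓ≡ p) , ℓ≢h ∘ trans (Path₂.ℓ≡ p) }

    clash : ∀ c₁ c₂ → Q c₁ → Q c₂ → c₁ ≢ c₂ → Ok c₂ c₁ → enter c₁ ≡ close c₂ ⊎ enter c₁ ≡ hop c₂
    clash c₁ c₂ q₁ q₂ ne ok = aux (enter c₁ ≟ₘ close c₂) (enter c₁ ≟ₘ hop c₂)
      where
      aux : Dec (enter c₁ ≡ close c₂) → Dec (enter c₁ ≡ hop c₂) → _
      aux (yes p) _ = inj₁ p
      aux (no _) (yes p) = inj₂ p
      aux (no ¬c) (no ¬h) = contradiction ok (no-path q₁ q₂ ne ¬c ¬h)

    ♯-ℓ : ∀ x → ♯ (λ c → S₁? c ×-dec ℓ c ≟ₘ x) ≤ 1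
    ♯-ℓ x = ♯-unique (λ c → S₁? c ×-dec ℓ c ≟ₘ x) λ _ _ (s , p) (_ , p′) → ℓ-unique s p p′

    -- Of the `F` middle edges, at most two are lost as `c₂` or `d`, at most three through `ℓ`,
    -- which is injective on `S₁`, then `h` through `enter c₁` and `t` through the other two labels.
    -- By `avoid` the label `enter c₁` is not heavy, so 2h ≤ F. Doubling F ≤ 5 + h + t gives F ≤ 10
    -- + 2t.
    blocked⇒crowded : ∀ {c₁ c₂} → Q c₁ → S₂ c₁ → ¬ ∃ (Usable c₂ c₁) →
      6 * e ≤ 10 + 2 * ♯ (λ f → fan? c₁ f ×-dec (via c₁ f ≟ₘ close c₂ ⊎-dec via c₁ f ≟ₘ hop c₂))
    blocked⇒crowded {c₁} {c₂} (bad , _) s₂@(_ , many) blocked = ≤-trans many (+-cancelˡ-≤ F _ _ (begin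
      F + F ≤⟨ +-mono-≤ cover cover ⟩
      (1 + 1 + (1 + (1 + 1)) + (h + t)) + (1 + 1 + (1 + (1 + 1)) + (h + t)) ≡⟨ arith h t ⟩
      2 * h + (10 + 2 * t) ≤⟨ +-monoˡ-≤ (10 + 2 * t) light ⟩
      F + (10 + 2 * t) ∎))
      where
      open ≤-Reasoning
      F h t : ℕ
      F = ♯ (fan? c₁)
      h = ♯ (viaClass? c₁ (enter c₁))
      t = ♯ (λ f → fan? c₁ f ×-dec (via c₁ f ≟ₘ close c₂ ⊎-dec via c₁ f ≟ₘ hop c₂))
      arith : ∀ h t → (1 + 1 + (1 + (1 + 1)) + (h + t)) + (1 + 1 + (1 + (1 + 1)) + (h + t)) ≡ 2 * h + (10 + 2 * t)
      arith = solve-∀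
      light : 2 * h ≤ F
      light = aux (label bad b)
        where
        aux : (∃ λ x → enter c₁ ≡ just x) → 2 * h ≤ F
        aux (x , ex) with IsSRow.avoid (row-of bad) (proj₁ (proj₂ (IsRow.sound (IsSRow.isRow (row-of bad)) d b ex)))
        ... | inj₁ (s₁ , _) = contradiction s₁ (proj₁ s₂)
        ... | inj₂ (_ , ¬heavy) = ≤-trans (≤-reflexive (cong (λ x → 2 * ♯ (viaClass? c₁ x)) ex)) (≮⇒≥ ¬heavy)
      ex₁ ex₂ : Pred (Fin m) 0ℓ
      ex₁ f = f ≡ c₂ ⊎ f ≡ d
      ex₂ f = (S₁ f × ℓ f ≡ enter c₁) ⊎ ((S₁ f × ℓ f ≡ close c₂) ⊎ (S₁ f × ℓ f ≡ hop c₂))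
      ex₁? : Decidable ex₁
      ex₁? f = f Fin.≟ c₂ ⊎-dec f Fin.≟ d
      ex₂? : Decidable ex₂
      ex₂? f = (S₁? f ×-dec ℓ f ≟ₘ enter c₁) ⊎-dec ((S₁? f ×-dec ℓ f ≟ₘ close c₂) ⊎-dec (S₁? f ×-dec ℓ f ≟ₘ hop c₂))
      ex₃? : Decidable (λ f → (Fan c₁ f × via c₁ f ≡ enter c₁) ⊎ (Fan c₁ f × (via c₁ f ≡ close c₂ ⊎ via c₁ f ≡ hop c₂)))
      ex₃? f = viaClass? c₁ (enter c₁) f ⊎-dec (fan? c₁ f ×-dec (via c₁ f ≟ₘ close c₂ ⊎-dec via c₁ f ≟ₘ hop c₂))
      cover : F ≤ 1 + 1 + (1 + (1 + 1)) + (h + t)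
      cover = ≤-trans (♯-mono (fan? c₁) (λ f → (ex₁? f ⊎-dec ex₂? f) ⊎-dec ex₃? f) split)
        (♯-∪ (λ f → ex₁? f ⊎-dec ex₂? f) ex₃?
          (♯-∪ ex₁? ex₂? (♯-∪ (Fin._≟ c₂) (Fin._≟ d) (♯-≟ c₂) (♯-≟ d))
            (♯-∪ (λ f → S₁? f ×-dec ℓ f ≟ₘ enter c₁) (λ f → (S₁? f ×-dec ℓ f ≟ₘ close c₂) ⊎-dec (S₁? f ×-dec ℓ f ≟ₘ hop c₂)) (♯-ℓ (enter c₁))
              (♯-∪ (λ f → S₁? f ×-dec ℓ f ≟ₘ close c₂) (λ f → S₁? f ×-dec ℓ f ≟ₘ hop c₂) (♯-ℓ (close c₂)) (♯-ℓ (hop c₂)))))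
          (♯-∪ (viaClass? c₁ (enter c₁)) (λ f → fan? c₁ f ×-dec (via c₁ f ≟ₘ close c₂ ⊎-dec via c₁ f ≟ₘ hop c₂)) ≤-refl ≤-refl))
        where
        split : ∀ f → Fan c₁ f → (ex₁ f ⊎ ex₂ f) ⊎ _
        split f fan with (ex₁? f ⊎-dec ex₂? f) ⊎-dec ex₃? f
        ... | yes p = p
        ... | no ¬p = contradiction (f , fan
              , ((λ q → ¬p (inj₁ (inj₁ (inj₁ q)))) , (λ q → ¬p (inj₁ (inj₁ (inj₂ q)))))
              , ((λ q → ¬p (inj₁ (inj₂ (inj₁ (proj₁ fan , q))))) , (λ q → ¬p (inj₁ (inj₂ (inj₂ (inj₁ (proj₁ fan , q))))))
                , (λ q → ¬p (inj₁ (inj₂ (inj₂ (inj₂ (proj₁ fan , q)))))))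
              , ((λ q → ¬p (inj₂ (inj₁ (fan , q)))) , (λ q → ¬p (inj₂ (inj₂ (fan , inj₁ q)))) , (λ q → ¬p (inj₂ (inj₂ (fan , inj₂ q)))))) blocked

    -- If `c₁` in `S₁` fails, then `ℓ c₁` is one of two given labels, each taken at most once. If
    -- `c₁` in `S₂` fails, it is crowded.
    rare : ∀ c₂ → Q c₂ → ♯ (λ c₁ → Q? c₁ ×-dec ¬? (ok? c₂ c₁)) ≤ 2 + e
    rare c₂ q₂ = ≤-trans (♯-mono (λ c₁ → Q? c₁ ×-dec ¬? (ok? c₂ c₁)) (λ c → (A? c ⊎-dec B? c) ⊎-dec crowded? (close c₂) (hop c₂) c) split)
      (♯-∪ (λ c → A? c ⊎-dec B? c) (crowded? (close c₂) (hop c₂)) (♯-∪ A? B? (♯-ℓ (close c₂)) (♯-ℓ (hop c₂))) (crowded-few (close c₂) (hop c₂)))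
      where
      A? : Decidable (λ c → S₁ c × ℓ c ≡ close c₂)
      A? c = S₁? c ×-dec ℓ c ≟ₘ close c₂
      B? : Decidable (λ c → S₁ c × ℓ c ≡ hop c₂)
      B? c = S₁? c ×-dec ℓ c ≟ₘ hop c₂
      split : ∀ c₁ → Q c₁ × ¬ Ok c₂ c₁ → ((S₁ c₁ × ℓ c₁ ≡ close c₂) ⊎ (S₁ c₁ × ℓ c₁ ≡ hop c₂)) ⊎ _
      split c₁ (q₁@((_ , s , _) , _) , ¬ok) = by s
        where
        by : S c₁ → ((S₁ c₁ × ℓ c₁ ≡ close c₂) ⊎ (S₁ c₁ × ℓ c₁ ≡ hop c₂)) ⊎ _
        by (inj₂ s₂) = inj₂ (blocked⇒crowded q₁ s₂ (¬ok ∘ inj₂))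
        by (inj₁ s₁) with ℓ c₁ ≟ₘ close c₂ | ℓ c₁ ≟ₘ hop c₂
        ... | yes p | _ = inj₁ (inj₁ (s₁ , p))
        ... | no _ | yes p = inj₁ (inj₂ (s₁ , p))
        ... | no ¬p | no ¬q = contradiction (inj₁ (s₁ , ¬p , ¬q)) ¬ok

    Q-few : ♯ Q? ≤ 3 * (2 + e + 1)
    Q-few = entering-closing-clash Q? enter close hop (λ c → enter≢close c ∘ proj₁) hop-injective ok? rare clash

  -- The two labels of a bad `c` at `d` differ, so at most one of them equals the label of `d` at
  -- `c`. Hence `c` satisfies `Q` for one of the two orientations of `d`.
  Bad-few : ∀ d → S d → ♯ (Bad? d) < 6 * e + 19
  Bad-few d sd = ≤-trans (s≤s (≤-trans (♯-⊎ (Bad? d) (Collision.Q? d sd true) (Collision.Q? d sd false) split)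
    (+-mono-≤ (Collision.Q-few d sd true) (Collision.Q-few d sd false)))) (≤-reflexive (arith e))
    where
    arith : ∀ e → suc (3 * (2 + e + 1) + 3 * (2 + e + 1)) ≡ 6 * e + 19
    arith = solve-∀
    split : ∀ c → Bad d c → Collision.Q d sd true c ⊎ Collision.Q d sd false c
    split c bad with ρ c d false ≟ₘ firstLabel (ρ d) c
    ... | no ¬p = inj₁ (bad , ¬p)
    ... | yes p = inj₂ (bad , λ p′ → Collision.enter≢close d sd true c bad (trans p′ (sym p)))

  impossible : ⊥
  impossible =
    let (c , s₁) = ♯-∃ S₁? (*-cancelˡ-< 2 0 _ (≤-trans (m≤n⇒m≤o+n m (m≤n⇒m≤o+n (12 * e) (s≤s z≤n))) S₁-many))
        (d , many) = surplus (c , inj₁ s₁)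
        (_ , sd , _) = ♯-∃ (Bad? d) (≤-trans (m≤n⇒m≤o+n (6 * e) (s≤s z≤n)) many)
    in <⇒≱ (Bad-few d sd) many

-- Rational arithmetic

-- Normalising `k / 1` does not reduce for a variable `k`, so the identities below are checked on
-- unnormalised fractions, where the final `0` encodes the denominator 1.
ℕtoℚᵘ : ∀ k → ℚ.toℚᵘ (ℕtoℚ k) ℚᵘ.≃ ℚᵘ.mkℚᵘ (ℤ.+ k) 0
ℕtoℚᵘ k = ℚ.toℚᵘ-fromℚᵘ (ℚᵘ.mkℚᵘ (ℤ.+ k) 0)

ℕtoℚ-+ : ∀ a b → ℕtoℚ (a + b) ≡ ℕtoℚ a ℚ.+ ℕtoℚ b
ℕtoℚ-+ a b = ℚ.toℚᵘ-injective (begin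
  ℚ.toℚᵘ (ℕtoℚ (a + b)) ≈⟨ ℕtoℚᵘ (a + b) ⟩
  ℚᵘ.mkℚᵘ (ℤ.+ (a + b)) 0 ≈⟨ ℚᵘ.*≡* (cong (ℤ._* ℤ.1ℤ) (cong₂ ℤ._+_ (sym (ℤ.*-identityʳ (ℤ.+ a))) (sym (ℤ.*-identityʳ (ℤ.+ b))))) ⟩
  ℚᵘ.mkℚᵘ (ℤ.+ a) 0 ℚᵘ.+ ℚᵘ.mkℚᵘ (ℤ.+ b) 0 ≈⟨ ℚᵘ.≃-sym (ℚᵘ.+-cong (ℕtoℚᵘ a) (ℕtoℚᵘ b)) ⟩
  ℚ.toℚᵘ (ℕtoℚ a) ℚᵘ.+ ℚ.toℚᵘ (ℕtoℚ b) ≈⟨ ℚᵘ.≃-sym (ℚ.toℚᵘ-homo-+ (ℕtoℚ a) (ℕtoℚ b)) ⟩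
  ℚ.toℚᵘ (ℕtoℚ a ℚ.+ ℕtoℚ b) ∎)
  where open ℚᵘ.≃-Reasoning

ℕtoℚ-* : ∀ a b → ℕtoℚ (a * b) ≡ ℕtoℚ a ℚ.* ℕtoℚ b
ℕtoℚ-* a b = ℚ.toℚᵘ-injective (begin
  ℚ.toℚᵘ (ℕtoℚ (a * b)) ≈⟨ ℕtoℚᵘ (a * b) ⟩
  ℚᵘ.mkℚᵘ (ℤ.+ (a * b)) 0 ≈⟨ ℚᵘ.*≡* (cong (ℤ._* ℤ.1ℤ) (ℤ.pos-* a b)) ⟩
  ℚᵘ.mkℚᵘ (ℤ.+ a) 0 ℚᵘ.* ℚᵘ.mkℚᵘ (ℤ.+ b) 0 ≈⟨ ℚᵘ.≃-sym (ℚᵘ.*-cong (ℕtoℚᵘ a) (ℕtoℚᵘ b)) ⟩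
  ℚ.toℚᵘ (ℕtoℚ a) ℚᵘ.* ℚ.toℚᵘ (ℕtoℚ b) ≈⟨ ℚᵘ.≃-sym (ℚ.toℚᵘ-homo-* (ℕtoℚ a) (ℕtoℚ b)) ⟩
  ℚ.toℚᵘ (ℕtoℚ a ℚ.* ℕtoℚ b) ∎)
  where open ℚᵘ.≃-Reasoning

ℕtoℚ-< : ∀ {a b} → a < b → ℕtoℚ a ℚ.< ℕtoℚ b
ℕtoℚ-< {a} {b} lt = ℚ.toℚᵘ-cancel-< (ℚᵘ.<-respˡ-≃ (ℚᵘ.≃-sym (ℕtoℚᵘ a)) (ℚᵘ.<-respʳ-≃ (ℚᵘ.≃-sym (ℕtoℚᵘ b))
  (ℚᵘ.*<* (ℤ.*-monoʳ-<-pos ℤ.1ℤ (ℤ.+<+ lt)))))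

ℕtoℚ-≤ : ∀ {a b} → a ≤ b → ℕtoℚ a ℚ.≤ ℕtoℚ b
ℕtoℚ-≤ {a} {b} le with m≤n⇒m<n∨m≡n le
... | inj₁ lt = ℚ.<⇒≤ (ℕtoℚ-< lt)
... | inj₂ refl = ℚ.≤-refl

square-< : ∀ {a b} → ℚ.0ℚ ℚ.≤ a → a ℚ.< b → a ℚ.* a ℚ.< b ℚ.* b
square-< {a} {b} 0≤a a<b = ℚ.≤-<-trans
  (ℚ.*-monoˡ-≤-nonNeg a ⦃ ℚ.nonNegative 0≤a ⦄ (ℚ.<⇒≤ a<b))
  (ℚ.*-monoˡ-<-pos b ⦃ ℚ.positive (ℚ.≤-<-trans 0≤a a<b) ⦄ a<b)

-- Otherwise δn < 12e, and squaring gives (δn)² < 144e² ≤ 144n, contrary to nδ² ≥ 144.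
enough-vertices : ∀ {δ n e K} → ℚ.0ℚ ℚ.< δ → ℕtoℚ 144 ℚ.≤ ℕtoℚ n ℚ.* (δ ℚ.* δ) → e * e ≤ n →
  (ℕtoℚ 3 ℚ.+ δ) ℚ.* ℕtoℚ n ℚ.≤ ℕtoℚ K → 3 * n + 12 * e ≤ K
enough-vertices {δ} {n} {e} {K} 0<δ big e²≤n many = ≮⇒≥ λ K< → ℚ.<-irrefl refl (begin-strict
  N ℚ.* ℕtoℚ 144 ≤⟨ ℚ.*-monoˡ-≤-nonNeg N big ⟩
  N ℚ.* (N ℚ.* (δ ℚ.* δ)) ≡⟨ solve 2 (λ x d → x :* (x :* (d :* d)) := (d :* x) :* (d :* x)) refl N δ ⟩
  (δ ℚ.* N) ℚ.* (δ ℚ.* N) <⟨ square-< 0≤δN (δN< K<) ⟩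
  ℕtoℚ (12 * e) ℚ.* ℕtoℚ (12 * e) ≡⟨ sym (ℕtoℚ-* (12 * e) (12 * e)) ⟩
  ℕtoℚ (12 * e * (12 * e)) ≤⟨ ℕtoℚ-≤ {12 * e * (12 * e)} {n * 144} (≤-trans (≤-reflexive (arith e)) (*-monoˡ-≤ 144 e²≤n)) ⟩
  ℕtoℚ (n * 144) ≡⟨ ℕtoℚ-* n 144 ⟩
  N ℚ.* ℕtoℚ 144 ∎)
  where
  open ℚ.≤-Reasoning
  open +-*-Solver
  N : ℚ.ℚ
  N = ℕtoℚ n
  instance
    N≥0 : ℚ.NonNegative N
    N≥0 = ℚ.nonNegative (ℕtoℚ-≤ {0} {n} z≤n)
  0≤δN : ℚ.0ℚ ℚ.≤ δ ℚ.* N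
  0≤δN = subst (ℚ._≤ δ ℚ.* N) (ℚ.*-zeroˡ N) (ℚ.*-monoʳ-≤-nonNeg N (ℚ.<⇒≤ 0<δ))
  arith : ∀ e → 12 * e * (12 * e) ≡ e * e * 144
  arith = solve-∀
  δN< : K < 3 * n + 12 * e → δ ℚ.* N ℚ.< ℕtoℚ (12 * e)
  δN< K< = begin-strict
    δ ℚ.* N ≡⟨ solve 3 (λ x d t → d :* x := (t :+ d) :* x :- t :* x) refl N δ (ℕtoℚ 3) ⟩
    (ℕtoℚ 3 ℚ.+ δ) ℚ.* N ℚ.- ℕtoℚ 3 ℚ.* N ≤⟨ ℚ.+-monoˡ-≤ (ℚ.- (ℕtoℚ 3 ℚ.* N)) many ⟩
    ℕtoℚ K ℚ.- ℕtoℚ 3 ℚ.* N <⟨ ℚ.+-monoˡ-< (ℚ.- (ℕtoℚ 3 ℚ.* N)) (ℕtoℚ-< K<) ⟩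
    ℕtoℚ (3 * n + 12 * e) ℚ.- ℕtoℚ 3 ℚ.* N ≡⟨ cong (ℚ._- ℕtoℚ 3 ℚ.* N) (trans (ℕtoℚ-+ (3 * n) (12 * e)) (cong (ℚ._+ ℕtoℚ (12 * e)) (ℕtoℚ-* 3 n))) ⟩
    ℕtoℚ 3 ℚ.* N ℚ.+ ℕtoℚ (12 * e) ℚ.- ℕtoℚ 3 ℚ.* N ≡⟨ solve 2 (λ s t → s :+ t :- s := t) refl (ℕtoℚ 3 ℚ.* N) (ℕtoℚ (12 * e)) ⟩
    ℕtoℚ (12 * e) ∎

-- Integer square roots and induction on the size of the matching

floor-sqrt : ∀ n → ∃ λ e → e * e ≤ n × n ≤ e * e + 2 * e
floor-sqrt zero = 0 , z≤n , z≤n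
floor-sqrt (suc n) with floor-sqrt n
... | e , lo , hi with m≤n⇒m<n∨m≡n hi
...   | inj₁ lt = e , m≤n⇒m≤1+n lo , lt
-- Here `suc n` is exactly the square of `suc e`.
...   | inj₂ refl = suc e , ≤-reflexive (arith e) , ≤-trans (≤-reflexive (sym (arith e))) (m≤m+n _ _)
  where
  arith : ∀ e → suc e * suc e ≡ suc (e * e + 2 * e)
  arith = solve-∀

theorem1p3 : (δ : ℚ.ℚ) → ℚ.0ℚ ℚ.< δ → (n : ℕ) →
    ℕtoℚ 144 ℚ.≤ ℕtoℚ n ℚ.* (δ ℚ.* δ) →
    (G : ColouredMultigraph n) →
    (∀ (c : Fin n) → DisjointUnionOfNontrivialCliques G c
    × AtLeastVertices G c ((ℕtoℚ 3 ℚ.+ δ) ℚ.* ℕtoℚ n)) →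
    Σ (List (Fin (ColouredMultigraph.E G))) λ M →
    length M ≡ n × RainbowMatching G M
theorem1p3 δ 0<δ n big G hyp = tabulate (proj₁ full) , length-tabulate (proj₁ full) , tabulate⁺ (proj₂ full _ _)
  where
  open ColouredMultigraph G
  open Graph G

  e : ℕ
  e = proj₁ (floor-sqrt n)

  -- The additional 3 over `12 * e` comes from `m < n`, that is, 3m + 3 ≤ 3n.
  vertices : ∀ {m} → m < n → ∀ γ → ∃ λ xs → Unique xs × All (InColour G γ) xs × 3 * m + (12 * e + 3) ≤ length xs
  vertices {m} m<n γ =
    let (xs , unique , inγ , many) = proj₂ (hyp γ) in
    xs , unique , inγ , ≤-trans (≤-reflexive (arith m e)) (≤-trans (+-monoˡ-≤ (12 * e) (*-monoʳ-≤ 3 m<n))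
      (enough-vertices {n = n} {e} {length xs} 0<δ big (proj₁ (proj₂ (floor-sqrt n))) many))
    where
    arith : ∀ m e → 3 * m + (12 * e + 3) ≡ 3 * suc m + 12 * e
    arith = solve-∀

  missing-colour : ∀ {m} → m < n → (μ : Fin m → Fin E) → ∃ (Missing μ)
  missing-colour {m} m<n μ with any? (λ γ → all? λ i → ¬? (colour (μ i) Fin.≟ γ))
  ... | yes h = h
  ... | no ¬h = contradiction (Fin.injective⇒≤ {f = preimage} injective) (<⇒≱ m<n)
    where
    hit : ∀ γ → ∃ λ i → colour (μ i) ≡ γ
    hit γ with any? (λ i → colour (μ i) Fin.≟ γ)
    ... | yes p = p
    ... | no ¬p = contradiction (γ , λ i eq → ¬p (i , eq)) ¬h
    preimage : Fin n → Fin m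
    preimage γ = proj₁ (hit γ)
    injective : ∀ {γ γ′} → preimage γ ≡ preimage γ′ → γ ≡ γ′
    injective {γ} {γ′} eq = trans (sym (proj₂ (hit γ))) (trans (cong (colour ∘ μ) eq) (proj₂ (hit γ′)))

  -- Induction on the size. If the search for `suc m` edges fails, the matching of size `m` is
  -- maximal and, as `m < n`, misses a colour, so `Main.impossible` applies.
  matching : ∀ m → m ≤ n → ∃ (IsMatching {m})
  matching zero _ = (λ ()) , λ ()
  matching (suc m) m<n with matching? (suc m)
  ... | yes M = M
  ... | no maximal =
    let (μ , M) = matching m (<⇒≤ m<n)
        (c₀ , c₀-missing) = missing-colour m<n μ
    in ⊥-elim (Main.impossible G μ M maximal c₀ c₀-missing e
         (≤-trans (<⇒≤ m<n) (proj₂ (proj₂ (floor-sqrt n)))) (proj₁ ∘ hyp) (vertices m<n))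

  full : ∃ (IsMatching {n})
  full = matching n ≤-refl
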